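{- Let $G=(V,E)$ be an undirected graph with $n=|V|$ vertices and degree bounds $b_v\in\mathbb{R}^+\cup\{\infty\}$ for $v\in V$, and let $(s_1,t_1),(s_2,t_2),\dots,(s_m,t_m)$ be a sequence of demands, where the endpoints of all demands are distinct vertices, each of degree one in $G$ and with degree bound $\infty$. Let $H_{\mathrm{GA}}$ be the final output of the greedy algorithm GA (described in the context) on this demand sequence. Then $$\max_{v\in V}\ell_{H_{\mathrm{GA}}}(v)\le O(\log n)\cdot \mathrm{OPT},$$ i.e., there is an absolute constant $c>0$ such that for every such instance, $\max_{v}\ell_{H_{\mathrm{GA}}}(v)\le c\log n\cdot \mathrm{OPT}$ (for $n\ge 2$).
   Context: Online degree-bounded Steiner forest: the graph $G$ and the degree bounds are known in advance; the demands $(s_i,t_i)$ (vertex pairs) arrive one by one. Upon arrival of demand $i$, an online algorithm must augment its current edge set (edges may only be added, never removed) so that $s_i$ and $t_i$ are connected. For a subgraph $H\subseteq G$ and vertex $v$, $\deg_H(v)$ is the degree of $v$ in $H$ and the load is $\ell_H(v)=\deg_H(v)/b_v$ (which is $0$ if $b_v=\infty$). $\mathrm{OPT}=\min_H\max_v \ell_H(v)$, the minimum taken over all subgraphs $H\subseteq G$ in which $s_i$ and $t_i$ are connected for every demand $i$. Greedy algorithm GA: start with $H=\emptyset$. An edge $(u,v)$ of $G$ is an extension edge w.r.t. $H$ if $u$ and $v$ are not connected in $H$. For an $(s,t)$-path $P$ in $G$, its extension part $P^*$ is the set of extension edges of $P$. The uptick load of a vertex is $\ell^+_H(v)=\ell_H(v)+2/b_v$,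 and $\ell^+_H(P^*)=\max_{v\in V(P^*)}\ell^+_H(v)$ where $V(P^*)$ is the set of endpoints of edges of $P^*$. On arrival of demand $(s_i,t_i)$, GA chooses an $(s_i,t_i)$-path $P_i$ in $G$ minimizing $\ell^+_H(P_i^*)$, breaking ties in favor of paths with fewer edges, and sets $H\leftarrow H\cup P_i^*$.
   Formalization: GA's ties are broken in favor of paths whose extension part P* has fewer edges, not paths P with fewer edges in total; under the literal rule a tie-respecting run can reach load 2N with OPT ≤ 2 and n = O(N³), so the stated bound would fail. -}

module Defs where

open import Data.Bool.Base using (Bool; true; false; T; _∨_)
open import Data.Bool.Properties using (∨-comm)
open import Data.Fin.Base using (Fin)
import Data.Fin.Properties as Fin
open import Data.Fin.Subset using (∣_∣)
import Data.Integer.Base as ℤ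
import Data.Integer.Properties as ℤ
open import Data.Integer.Solver using () renaming (module +-*-Solver to ℤ-Solver)
open import Data.List.Base using (List; []; _∷_; foldr; map; concatMap; length; allFin; filter)
open import Data.List.Membership.Propositional using (_∈_)
open import Data.List.Membership.Propositional.Properties using (∈-allFin; ∈-filter⁻)
open import Data.List.Relation.Unary.All using (All)
open import Data.List.Relation.Unary.Any using (here; there)
open import Data.List.Relation.Unary.Unique.Propositional using (Unique)
open import Data.Nat.Base as ℕ using (ℕ; zero; suc; ⌊_/2⌋; s≤s; z≤n)
open import Data.Nat.Induction using (<-wellFounded)
open import Data.Nat.Logarithm using (⌊log₂_⌋; ⌊log₂⌋-mono-≤; ⌊log₂[2^n]⌋≡n)
open import Data.Nat.Logarithm.Core using (⌊log2⌋)
import Data.Nat.Properties as ℕ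
open import Data.Product.Base using (∃; _×_; _,_; proj₁; proj₂)
import Data.Product.Properties as Product
open import Data.Rational.Base as ℚ using (ℚ; mkℚ; 0ℚ; 1ℚ; ½; _+_; _*_; _-_; -_; 1/_; _⊔_; _<_; _≤_; positive; nonNegative) renaming (∣_∣ to abs)
open import Data.Rational.Properties as ℚ using (module ≤-Reasoning)
open import Data.Rational.Solver using (module +-*-Solver)
open import Data.Rational.Unnormalised.Base as ℚᵘ using (mkℚᵘ; *≡*; *≤*; *<*)
import Data.Rational.Unnormalised.Properties as ℚᵘ
open import Data.Sum.Base using (_⊎_; inj₁; inj₂)
open import Data.Vec.Base using (tabulate)
open import Induction.WellFounded using (Acc; acc)
open import Relation.Binary.Construct.Closure.ReflexiveTransitive using (Star; ε; _◅_; _◅◅_)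
open import Relation.Binary.PropositionalEquality using (_≡_; refl; sym; trans; cong; cong₂; subst; subst₂)
open import Relation.Nullary using (¬_; Dec; yes; no; contradiction)
open import Relation.Nullary.Decidable using (⌊_⌋; map′; _⊎-dec_; _×-dec_; ¬?; T?)

open +-*-Solver using (solve; _:+_; _:*_; _:-_; :-_; _:=_)
open ℤ-Solver using () renaming (solve to ℤsolve; con to ℤcon; _:+_ to _ℤ:+_; _:*_ to _ℤ:*_; _:=_ to _ℤ:=_)

-- Real numbers: Cauchy sequences of rationals, compared up to _≈ᴿ_.

IsCauchy : (ℕ → ℚ) → Set
IsCauchy s = ∀ δ → 0ℚ < δ → ∃ λ N → ∀ {m n} → N ℕ.≤ m → N ℕ.≤ n → abs (s m - s n) < δ

record ℝ : Set where
  constructor mkℝ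
  field
    seq    : ℕ → ℚ
    cauchy : IsCauchy seq

open ℝ public

infix 4 _≤ᴿ_ _<ᴿ_ _≈ᴿ_

_≤ᴿ_ : ℝ → ℝ → Set
x ≤ᴿ y = ∀ δ → 0ℚ < δ → ∃ λ N → ∀ {n} → N ℕ.≤ n → seq x n ≤ seq y n + δ

_<ᴿ_ : ℝ → ℝ → Set
x <ᴿ y = ∃ λ δ → 0ℚ < δ × ∃ λ N → ∀ {n} → N ℕ.≤ n → seq x n + δ ≤ seq y n

_≈ᴿ_ : ℝ → ℝ → Set
x ≈ᴿ y = x ≤ᴿ y × y ≤ᴿ x

private

  abs< : ∀ p q {δ} → p < q + δ → q < p + δ → abs (p - q) < δ
  abs< p q {δ} p<q+δ q<p+δ with ℚ.∣p∣≡p∨∣p∣≡-p (p - q)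
  ... | inj₁ eq = begin-strict
    abs (p - q)   ≡⟨ eq ⟩
    p - q         <⟨ ℚ.+-monoˡ-< (- q) p<q+δ ⟩
    (q + δ) - q   ≡⟨ solve 2 (λ q δ → (q :+ δ) :- q := δ) refl q δ ⟩
    δ             ∎
    where open ≤-Reasoning
  ... | inj₂ eq = begin-strict
    abs (p - q)   ≡⟨ eq ⟩
    - (p - q)     ≡⟨ solve 2 (λ p q → :- (p :- q) := q :- p) refl p q ⟩
    q - p         <⟨ ℚ.+-monoˡ-< (- p) q<p+δ ⟩
    (p + δ) - p   ≡⟨ solve 2 (λ p δ → (p :+ δ) :- p := δ) refl p δ ⟩
    δ             ∎
    where open ≤-Reasoning

  0≤abs : ∀ p → 0ℚ ≤ abs p
  0≤abs p = ℚ.nonNegative⁻¹ (abs p) {{ℚ.∣-∣-nonNeg p}}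

  p≤∣p∣ : ∀ p → p ≤ abs p
  p≤∣p∣ p with ℚ.≤-total 0ℚ p
  ... | inj₁ 0≤p = ℚ.≤-reflexive (sym (ℚ.0≤p⇒∣p∣≡p 0≤p))
  ... | inj₂ p≤0 = ℚ.≤-trans p≤0 (0≤abs p)

  abs<⁻ : ∀ p q {δ} → abs (p - q) < δ → p < q + δ
  abs<⁻ p q {δ} d = begin-strict
    p            ≡⟨ solve 2 (λ p q → p := q :+ (p :- q)) refl p q ⟩
    q + (p - q)  <⟨ ℚ.+-monoʳ-< q (ℚ.≤-<-trans (p≤∣p∣ (p - q)) d) ⟩
    q + δ        ∎
    where open ≤-Reasoning

  0<* : ∀ {p q} → 0ℚ < p → 0ℚ < q → 0ℚ < p * q
  0<* {p} {q} 0<p 0<q = subst (_< p * q) (ℚ.*-zeroʳ p)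
    (ℚ.*-monoʳ-<-pos p {{positive 0<p}} 0<q)

  0<½ : 0ℚ < ½
  0<½ = ℚ.positive⁻¹ ½

  ½+½ : ∀ δ → ½ * δ + ½ * δ ≡ δ
  ½+½ δ = trans (sym (ℚ.*-distribʳ-+ δ ½ ½)) (ℚ.*-identityˡ δ)

  shrink : ∀ {B δ} → 0ℚ < B → 0ℚ < δ → ∃ λ η → 0ℚ < η × B * η ≡ δ
  shrink {B} {δ} 0<B 0<δ = 1/B * δ , 0<* (ℚ.positive⁻¹ 1/B {{ℚ.1/pos⇒pos B}}) 0<δ , eq
    where
    instance
      B⁺ : ℚ.Positive B
      B⁺ = positive 0<B
      B≢0 : ℚ.NonZero B
      B≢0 = ℚ.pos⇒nonZero B
    1/B : ℚ
    1/B = 1/ B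
    eq : B * (1/B * δ) ≡ δ
    eq = trans (sym (ℚ.*-assoc B 1/B δ)) (trans (cong (_* δ) (ℚ.*-inverseʳ B)) (ℚ.*-identityˡ δ))

  module _ (x : ℝ) where

    private
      N₁ : ℕ
      N₁ = proj₁ (cauchy x 1ℚ (ℚ.positive⁻¹ 1ℚ))

    tailBound : ℚ
    tailBound = abs (seq x N₁) + 1ℚ

    tailBound>0 : 0ℚ < tailBound
    tailBound>0 = ℚ.+-mono-≤-< (0≤abs (seq x N₁)) (ℚ.positive⁻¹ 1ℚ)

    tailFrom : ℕ
    tailFrom = N₁

    tail≤ : ∀ {n} → tailFrom ℕ.≤ n → abs (seq x n) ≤ tailBound
    tail≤ {n} N≤n = begin
      abs a             ≡⟨ cong abs (solve 2 (λ a c → a := c :+ (a :- c)) refl a c) ⟩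
      abs (c + (a - c)) ≤⟨ ℚ.∣p+q∣≤∣p∣+∣q∣ c (a - c) ⟩
      abs c + abs (a - c) ≤⟨ ℚ.+-monoʳ-≤ (abs c) (ℚ.<⇒≤ (proj₂ (cauchy x 1ℚ _) N≤n ℕ.≤-refl)) ⟩
      abs c + 1ℚ        ∎
      where
      open ≤-Reasoning
      a = seq x n
      c = seq x N₁

  *-mono-≤ : ∀ {p q r s} → 0ℚ ≤ p → 0ℚ ≤ s → p ≤ q → r ≤ s → p * r ≤ q * s
  *-mono-≤ {p} {q} {r} {s} 0≤p 0≤s p≤q r≤s = ℚ.≤-trans
    (ℚ.*-monoˡ-≤-nonNeg p {{nonNegative 0≤p}} r≤s)
    (ℚ.*-monoʳ-≤-nonNeg s {{nonNegative 0≤s}} p≤q)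

infixl 6 _+ᴿ_ _⊔ᴿ_
infixl 7 _*ᴿ_

recip : ℚ → ℚ
recip q with q ℚ.≟ 0ℚ
... | yes _  = 0ℚ
... | no q≢0 = (1/ q) {{ℚ.≢-nonZero q≢0}}

private

  recip-inverse : ∀ {q} → 0ℚ < q → q * recip q ≡ 1ℚ
  recip-inverse {q} 0<q with q ℚ.≟ 0ℚ
  ... | yes q≡0 = contradiction (sym q≡0) (ℚ.<⇒≢ 0<q)
  ... | no q≢0  = ℚ.*-inverseʳ q {{ℚ.≢-nonZero q≢0}}

-- The convergence proofs are abstract: nothing depends on the modulus, and
-- unfolding it makes terms explode.
abstract

  const-cauchy : ∀ q → IsCauchy (λ _ → q)
  const-cauchy q δ 0<δ = 0 , λ _ _ → subst (λ z → abs z < δ) (sym (ℚ.+-inverseʳ q)) 0<δ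

  +-cauchy : ∀ x y → IsCauchy (λ n → seq x n + seq y n)
  +-cauchy x y δ 0<δ =
    let (M , hx) = cauchy x (½ * δ) (0<* 0<½ 0<δ)
        (N , hy) = cauchy y (½ * δ) (0<* 0<½ 0<δ)
    in M ℕ.⊔ N , λ {m} {n} p q → begin-strict
      abs ((seq x m + seq y m) - (seq x n + seq y n))
        ≡⟨ cong abs (solve 4 (λ a b c d → (a :+ b) :- (c :+ d) := (a :- c) :+ (b :- d)) refl
             (seq x m) (seq y m) (seq x n) (seq y n)) ⟩
      abs ((seq x m - seq x n) + (seq y m - seq y n))
        ≤⟨ ℚ.∣p+q∣≤∣p∣+∣q∣ (seq x m - seq x n) (seq y m - seq y n) ⟩
      abs (seq x m - seq x n) + abs (seq y m - seq y n)
        <⟨ ℚ.+-mono-< (hx (ℕ.m⊔n≤o⇒m≤o M N p) (ℕ.m⊔n≤o⇒m≤o M N q))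
                      (hy (ℕ.m⊔n≤o⇒n≤o M N p) (ℕ.m⊔n≤o⇒n≤o M N q)) ⟩
      ½ * δ + ½ * δ
        ≡⟨ ½+½ δ ⟩
      δ ∎
    where open ≤-Reasoning

  *-cauchy : ∀ x y → IsCauchy (λ n → seq x n * seq y n)
  *-cauchy x y = isCauchy
    where
    open ≤-Reasoning
    B C : ℚ
    B = tailBound x
    C = tailBound y
    isCauchy : IsCauchy (λ n → seq x n * seq y n)
    isCauchy δ 0<δ = K , close
      where
      ½δ>0 : 0ℚ < ½ * δ
      ½δ>0 = 0<* 0<½ 0<δ
      η-y : ∃ λ η → 0ℚ < η × B * η ≡ ½ * δ
      η-y = shrink (tailBound>0 x) ½δ>0
      η-x : ∃ λ η → 0ℚ < η × C * η ≡ ½ * δ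
      η-x = shrink (tailBound>0 y) ½δ>0
      cx : ∃ λ N → ∀ {m n} → N ℕ.≤ m → N ℕ.≤ n → abs (seq x m - seq x n) < proj₁ η-x
      cx = cauchy x (proj₁ η-x) (proj₁ (proj₂ η-x))
      cy : ∃ λ N → ∀ {m n} → N ℕ.≤ m → N ℕ.≤ n → abs (seq y m - seq y n) < proj₁ η-y
      cy = cauchy y (proj₁ η-y) (proj₁ (proj₂ η-y))
      K₁ K₂ K : ℕ
      K₁ = tailFrom x ℕ.⊔ tailFrom y
      K₂ = proj₁ cx ℕ.⊔ proj₁ cy
      K = K₁ ℕ.⊔ K₂
      close : ∀ {m n} → K ℕ.≤ m → K ℕ.≤ n → abs (seq x m * seq y m - seq x n * seq y n) < δ
      close {m} {n} p q = begin-strict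
        abs (a * b - c * d)
          ≡⟨ cong abs (solve 4 (λ a b c d → a :* b :- c :* d := a :* (b :- d) :+ d :* (a :- c)) refl a b c d) ⟩
        abs (a * (b - d) + d * (a - c))
          ≤⟨ ℚ.∣p+q∣≤∣p∣+∣q∣ (a * (b - d)) (d * (a - c)) ⟩
        abs (a * (b - d)) + abs (d * (a - c))
          ≡⟨ cong₂ _+_ (ℚ.∣p*q∣≡∣p∣*∣q∣ a (b - d)) (ℚ.∣p*q∣≡∣p∣*∣q∣ d (a - c)) ⟩
        abs a * abs (b - d) + abs d * abs (a - c)
          ≤⟨ ℚ.+-mono-≤ step-a step-d ⟩
        B * abs (b - d) + C * abs (a - c)
          <⟨ ℚ.+-mono-< step-y step-x ⟩
        B * proj₁ η-y + C * proj₁ η-x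
          ≡⟨ cong₂ _+_ (proj₂ (proj₂ η-y)) (proj₂ (proj₂ η-x)) ⟩
        ½ * δ + ½ * δ
          ≡⟨ ½+½ δ ⟩
        δ ∎
        where
        a b c d : ℚ
        a = seq x m
        b = seq y m
        c = seq x n
        d = seq y n
        N₁ N₂ : ℕ
        N₁ = proj₁ cx
        N₂ = proj₁ cy
        p₁ : K₁ ℕ.≤ m
        p₁ = ℕ.m⊔n≤o⇒m≤o K₁ K₂ p
        q₁ : K₁ ℕ.≤ n
        q₁ = ℕ.m⊔n≤o⇒m≤o K₁ K₂ q
        p₂ : K₂ ℕ.≤ m
        p₂ = ℕ.m⊔n≤o⇒n≤o K₁ K₂ p
        q₂ : K₂ ℕ.≤ n
        q₂ = ℕ.m⊔n≤o⇒n≤o K₁ K₂ q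
        step-a : abs a * abs (b - d) ≤ B * abs (b - d)
        step-a = ℚ.*-monoʳ-≤-nonNeg (abs (b - d)) {{ℚ.∣-∣-nonNeg (b - d)}}
          (tail≤ x {m} (ℕ.m⊔n≤o⇒m≤o (tailFrom x) (tailFrom y) p₁))
        step-d : abs d * abs (a - c) ≤ C * abs (a - c)
        step-d = ℚ.*-monoʳ-≤-nonNeg (abs (a - c)) {{ℚ.∣-∣-nonNeg (a - c)}}
          (tail≤ y {n} (ℕ.m⊔n≤o⇒n≤o (tailFrom x) (tailFrom y) q₁))
        step-y : B * abs (b - d) < B * proj₁ η-y
        step-y = ℚ.*-monoʳ-<-pos B {{positive (tailBound>0 x)}}
          (proj₂ cy {m} {n} (ℕ.m⊔n≤o⇒n≤o N₁ N₂ p₂) (ℕ.m⊔n≤o⇒n≤o N₁ N₂ q₂))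
        step-x : C * abs (a - c) < C * proj₁ η-x
        step-x = ℚ.*-monoʳ-<-pos C {{positive (tailBound>0 y)}}
          (proj₂ cx {m} {n} (ℕ.m⊔n≤o⇒m≤o N₁ N₂ p₂) (ℕ.m⊔n≤o⇒m≤o N₁ N₂ q₂))

  ⊔-cauchy : ∀ x y → IsCauchy (λ n → seq x n ⊔ seq y n)
  ⊔-cauchy x y δ 0<δ =
    let (M , hx) = cauchy x δ 0<δ
        (N , hy) = cauchy y δ 0<δ
        below : ∀ {m n} → M ℕ.⊔ N ℕ.≤ m → M ℕ.⊔ N ℕ.≤ n → seq x m ⊔ seq y m < (seq x n ⊔ seq y n) + δ
        below {m} {n} p q = ⊔-lub-< (seq x m) (seq y m)
          (ℚ.<-≤-trans (abs<⁻ (seq x m) (seq x n) (hx (ℕ.m⊔n≤o⇒m≤o M N p) (ℕ.m⊔n≤o⇒m≤o M N q)))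
                       (ℚ.+-monoˡ-≤ δ (ℚ.p≤p⊔q (seq x n) (seq y n))))
          (ℚ.<-≤-trans (abs<⁻ (seq y m) (seq y n) (hy (ℕ.m⊔n≤o⇒n≤o M N p) (ℕ.m⊔n≤o⇒n≤o M N q)))
                       (ℚ.+-monoˡ-≤ δ (ℚ.p≤q⊔p (seq x n) (seq y n))))
    in M ℕ.⊔ N , λ {m} {n} p q → abs< (seq x m ⊔ seq y m) (seq x n ⊔ seq y n) (below p q) (below q p)
    where
    ⊔-lub-< : ∀ p q {r} → p < r → q < r → p ⊔ q < r
    ⊔-lub-< p q {r} p<r q<r with ℚ.⊔-sel p q
    ... | inj₁ eq = subst (_< r) (sym eq) p<r
    ... | inj₂ eq = subst (_< r) (sym eq) q<r

  recip-cauchy : ∀ x → (∃ λ β → 0ℚ < β × ∃ λ N → ∀ {n} → N ℕ.≤ n → 0ℚ + β ≤ seq x n) → IsCauchy (λ n → recip (seq x n))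
  recip-cauchy x (β , 0<β , N₀ , β≤) = isCauchy
    where
    open ≤-Reasoning
    isCauchy : IsCauchy (λ n → recip (seq x n))
    isCauchy δ 0<δ = K , close
      where
      η : ℚ
      η = δ * (β * β)
      0<η : 0ℚ < η
      0<η = 0<* 0<δ (0<* 0<β 0<β)
      cx : ∃ λ N → ∀ {m n} → N ℕ.≤ m → N ℕ.≤ n → abs (seq x m - seq x n) < η
      cx = cauchy x η 0<η
      K : ℕ
      K = N₀ ℕ.⊔ proj₁ cx
      close : ∀ {m n} → K ℕ.≤ m → K ℕ.≤ n → abs (recip (seq x m) - recip (seq x n)) < δ
      close {m} {n} p q = ℚ.*-cancelʳ-<-nonNeg (a * b) {{nonNegative (ℚ.<⇒≤ (0<* 0<a 0<b))}} (begin-strict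
        abs (u - v) * (a * b)
          ≡⟨ cong (abs (u - v) *_) (sym (ℚ.0≤p⇒∣p∣≡p (ℚ.<⇒≤ (0<* 0<a 0<b)))) ⟩
        abs (u - v) * abs (a * b)
          ≡⟨ sym (ℚ.∣p*q∣≡∣p∣*∣q∣ (u - v) (a * b)) ⟩
        abs ((u - v) * (a * b))
          ≡⟨ cong abs (solve 4 (λ a b u v → (u :- v) :* (a :* b) := (a :* u) :* b :- (b :* v) :* a) refl a b u v) ⟩
        abs ((a * u) * b - (b * v) * a)
          ≡⟨ cong abs (cong₂ (λ s t → s * b - t * a) (recip-inverse 0<a) (recip-inverse 0<b)) ⟩
        abs (1ℚ * b - 1ℚ * a)
          ≡⟨ cong abs (cong₂ _-_ (ℚ.*-identityˡ b) (ℚ.*-identityˡ a)) ⟩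
        abs (b - a)
          <⟨ proj₂ cx (ℕ.m⊔n≤o⇒n≤o N₀ _ q) (ℕ.m⊔n≤o⇒n≤o N₀ _ p) ⟩
        δ * (β * β)
          ≤⟨ ℚ.*-monoˡ-≤-nonNeg δ {{nonNegative (ℚ.<⇒≤ 0<δ)}}
               (*-mono-≤ (ℚ.<⇒≤ 0<β) (ℚ.<⇒≤ 0<b) β≤a β≤b) ⟩
        δ * (a * b) ∎)
        where
        a b u v : ℚ
        a = seq x m
        b = seq x n
        u = recip a
        v = recip b
        β≤a : β ≤ a
        β≤a = subst (_≤ a) (ℚ.+-identityˡ β) (β≤ (ℕ.m⊔n≤o⇒m≤o N₀ _ p))
        β≤b : β ≤ b
        β≤b = subst (_≤ b) (ℚ.+-identityˡ β) (β≤ (ℕ.m⊔n≤o⇒m≤o N₀ _ q))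
        0<a : 0ℚ < a
        0<a = ℚ.<-≤-trans 0<β β≤a
        0<b : 0ℚ < b
        0<b = ℚ.<-≤-trans 0<β β≤b

fromℚ : ℚ → ℝ
fromℚ q = mkℝ (λ _ → q) (const-cauchy q)

0ᴿ : ℝ
0ᴿ = fromℚ 0ℚ

fromℕ : ℕ → ℝ
fromℕ n = fromℚ (ℤ.+ n ℚ./ 1)

_+ᴿ_ : ℝ → ℝ → ℝ
x +ᴿ y = mkℝ (λ n → seq x n + seq y n) (+-cauchy x y)

_*ᴿ_ : ℝ → ℝ → ℝ
x *ᴿ y = mkℝ (λ n → seq x n * seq y n) (*-cauchy x y)

_⊔ᴿ_ : ℝ → ℝ → ℝ
x ⊔ᴿ y = mkℝ (λ n → seq x n ⊔ seq y n) (⊔-cauchy x y)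

-- Positivity makes all but finitely many terms of x nonzero, so the junk
-- value recip 0 = 0 does not affect the limit.
inv : (x : ℝ) → 0ᴿ <ᴿ x → ℝ
inv x 0<x = mkℝ (λ n → recip (seq x n)) (recip-cauchy x 0<x)

private

  2*⌊n/2⌋≤n : ∀ n → 2 ℕ.* ⌊ n /2⌋ ℕ.≤ n
  2*⌊n/2⌋≤n zero          = z≤n
  2*⌊n/2⌋≤n (suc zero)    = z≤n
  2*⌊n/2⌋≤n (suc (suc n)) =
    subst (ℕ._≤ suc (suc n)) (sym (ℕ.*-distribˡ-+ 2 1 ⌊ n /2⌋)) (s≤s (s≤s (2*⌊n/2⌋≤n n)))

  2^⌊log2⌋≤ : ∀ n (a : Acc ℕ._<_ (suc n)) → 2 ℕ.^ ⌊log2⌋ (suc n) a ℕ.≤ suc n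
  2^⌊log2⌋≤ zero    _        = s≤s z≤n
  2^⌊log2⌋≤ (suc n) (acc rs) = ℕ.≤-trans
    (ℕ.*-monoʳ-≤ 2 (2^⌊log2⌋≤ ⌊ n /2⌋ (rs (ℕ.⌊n/2⌋<n (suc n)))))
    (2*⌊n/2⌋≤n (suc (suc n)))

  2^⌊log₂⌋≤ : ∀ n .{{_ : ℕ.NonZero n}} → 2 ℕ.^ ⌊log₂ n ⌋ ℕ.≤ n
  2^⌊log₂⌋≤ (suc n) = 2^⌊log2⌋≤ n (<-wellFounded (suc n))

  <2^1+⌊log₂⌋ : ∀ n → n ℕ.< 2 ℕ.^ suc ⌊log₂ n ⌋
  <2^1+⌊log₂⌋ n with n ℕ.<? 2 ℕ.^ suc ⌊log₂ n ⌋
  ... | yes p = p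
  ... | no ¬p = contradiction
    (subst (ℕ._≤ ⌊log₂ n ⌋) (⌊log₂[2^n]⌋≡n (suc ⌊log₂ n ⌋)) (⌊log₂⌋-mono-≤ (ℕ.≮⇒≥ ¬p)))
    ℕ.1+n≰n

  module _ (n : ℕ) .{{_ : ℕ.NonZero n}} where

    private
      L : ℕ → ℕ
      L k = ⌊log₂ n ℕ.^ suc k ⌋

    log₂-cross : ∀ j k → L j ℕ.* suc k ℕ.≤ suc (L k) ℕ.* suc j
    log₂-cross j k with L j ℕ.* suc k ℕ.≤? suc (L k) ℕ.* suc j
    ... | yes p = p
    ... | no ¬p = contradiction chain (ℕ.n≮n _)
      where
      open ℕ.≤-Reasoning
      chain : 2 ℕ.^ (L j ℕ.* suc k) ℕ.< 2 ℕ.^ (L j ℕ.* suc k)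
      chain = begin-strict
        2 ℕ.^ (L j ℕ.* suc k)          ≡⟨ sym (ℕ.^-*-assoc 2 (L j) (suc k)) ⟩
        (2 ℕ.^ L j) ℕ.^ suc k          ≤⟨ ℕ.^-monoˡ-≤ (suc k) (2^⌊log₂⌋≤ (n ℕ.^ suc j) {{ℕ.m^n≢0 n (suc j)}}) ⟩
        (n ℕ.^ suc j) ℕ.^ suc k        ≡⟨ ℕ.^-*-assoc n (suc j) (suc k) ⟩
        n ℕ.^ (suc j ℕ.* suc k)        ≡⟨ cong (n ℕ.^_) (ℕ.*-comm (suc j) (suc k)) ⟩
        n ℕ.^ (suc k ℕ.* suc j)        ≡⟨ sym (ℕ.^-*-assoc n (suc k) (suc j)) ⟩
        (n ℕ.^ suc k) ℕ.^ suc j        <⟨ ℕ.^-monoˡ-< (suc j) (<2^1+⌊log₂⌋ (n ℕ.^ suc k)) ⟩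
        (2 ℕ.^ suc (L k)) ℕ.^ suc j    ≡⟨ ℕ.^-*-assoc 2 (suc (L k)) (suc j) ⟩
        2 ℕ.^ (suc (L k) ℕ.* suc j)    ≤⟨ ℕ.^-monoʳ-≤ 2 (ℕ.<⇒≤ (ℕ.≰⇒> ¬p)) ⟩
        2 ℕ.^ (L j ℕ.* suc k)          ∎

    log₂-step : ∀ j k → ℤ.+ L j ℚ./ suc j ≤ ℤ.+ L k ℚ./ suc k + ℤ.+ 1 ℚ./ suc k
    log₂-step j k = ℚ.toℚᵘ-cancel-≤ (begin
      ℚ.toℚᵘ (ℤ.+ L j ℚ./ suc j)
        ≃⟨ ℚ.toℚᵘ-fromℚᵘ (mkℚᵘ (ℤ.+ L j) j) ⟩
      mkℚᵘ (ℤ.+ L j) j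
        ≤⟨ *≤* (subst₂ ℤ._≤_ (ℤ.pos-* (L j) (suc k)) (ℤ.pos-* (suc (L k)) (suc j)) (ℤ.+≤+ (log₂-cross j k))) ⟩
      mkℚᵘ (ℤ.+ suc (L k)) k
        ≃⟨ add ⟩
      mkℚᵘ (ℤ.+ L k) k ℚᵘ.+ mkℚᵘ (ℤ.+ 1) k
        ≃⟨ ℚᵘ.+-cong (ℚᵘ.≃-sym (ℚ.toℚᵘ-fromℚᵘ (mkℚᵘ (ℤ.+ L k) k))) (ℚᵘ.≃-sym (ℚ.toℚᵘ-fromℚᵘ (mkℚᵘ (ℤ.+ 1) k))) ⟩
      ℚ.toℚᵘ (ℤ.+ L k ℚ./ suc k) ℚᵘ.+ ℚ.toℚᵘ (ℤ.+ 1 ℚ./ suc k)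
        ≃⟨ ℚᵘ.≃-sym (ℚ.toℚᵘ-homo-+ (ℤ.+ L k ℚ./ suc k) (ℤ.+ 1 ℚ./ suc k)) ⟩
      ℚ.toℚᵘ (ℤ.+ L k ℚ./ suc k + ℤ.+ 1 ℚ./ suc k) ∎)
      where
      open ℚᵘ.≤-Reasoning
      add : mkℚᵘ (ℤ.+ suc (L k)) k ℚᵘ.≃ mkℚᵘ (ℤ.+ L k) k ℚᵘ.+ mkℚᵘ (ℤ.+ 1) k
      add = *≡* (ℤsolve 2 (λ l s → (ℤcon (ℤ.+ 1) ℤ:+ l) ℤ:* (s ℤ:* s) ℤ:= (l ℤ:* s ℤ:+ ℤcon (ℤ.+ 1) ℤ:* s) ℤ:* s)
                  refl (ℤ.+ L k) (ℤ.+ suc k))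

  archimedean : ∀ δ → 0ℚ < δ → ∃ λ N → ∀ {n} → N ℕ.≤ n → ℤ.+ 1 ℚ./ suc n < δ
  archimedean δ@(mkℚ (ℤ.+ suc p) d _) 0<δ = suc d , λ {n} d<n →
    ℚ.toℚᵘ-cancel-< (ℚᵘ.≤-<-trans (ℚᵘ.≤-reflexive (ℚ.toℚᵘ-fromℚᵘ (mkℚᵘ (ℤ.+ 1) n)))
      (*<* (subst₂ ℤ._<_ (ℤ.pos-* 1 (suc d)) (ℤ.pos-* (suc p) (suc n)) (ℤ.+<+
        (ℕ.<-≤-trans (subst (ℕ._< suc n) (sym (ℕ.*-identityˡ (suc d))) (s≤s d<n)) (ℕ.m≤n*m (suc n) (suc p)))))))
  archimedean δ@(mkℚ ℤ.+0 d _) 0<δ with positive 0<δ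
  ... | ()
  archimedean δ@(mkℚ ℤ.-[1+ p ] d _) 0<δ with positive 0<δ
  ... | ()

abstract

  log₂-cauchy : ∀ n .{{_ : ℕ.NonZero n}} → IsCauchy (λ k → ℤ.+ ⌊log₂ n ℕ.^ suc k ⌋ ℚ./ suc k)
  log₂-cauchy n δ 0<δ =
    let (N , small) = archimedean δ 0<δ
        below : ∀ {i} j → N ℕ.≤ i → ℤ.+ ⌊log₂ n ℕ.^ suc j ⌋ ℚ./ suc j < ℤ.+ ⌊log₂ n ℕ.^ suc i ⌋ ℚ./ suc i + δ
        below {i} j N≤i = ℚ.≤-<-trans (log₂-step n j i) (ℚ.+-monoʳ-< (ℤ.+ ⌊log₂ n ℕ.^ suc i ⌋ ℚ./ suc i) (small N≤i))
    in N , λ {j} {k} N≤j N≤k → abs< (ℤ.+ ⌊log₂ n ℕ.^ suc j ⌋ ℚ./ suc j) (ℤ.+ ⌊log₂ n ℕ.^ suc k ⌋ ℚ./ suc k) (below j N≤k) (below k N≤j)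

-- log₂ n is the limit of ⌊log₂ nᵏ⌋ / k as k → ∞; log₂ 0 is a junk value.
log₂ : ℕ → ℝ
log₂ zero = 0ᴿ
log₂ n@(suc _) = mkℝ (λ k → ℤ.+ ⌊log₂ n ℕ.^ suc k ⌋ ℚ./ suc k) (log₂-cauchy n)

record Graph (n : ℕ) : Set where
  field
    adj     : Fin n → Fin n → Bool
    adj-sym : ∀ u v → adj u v ≡ adj v u
    no-loop : ∀ v → adj v v ≡ false

open Graph public

module _ {n : ℕ} where

  Adj : Graph n → Fin n → Fin n → Set
  Adj G u v = T (adj G u v)

  -- Subgraphs are spanning: a set of edges on the same vertices.
  _⊆_ : Graph n → Graph n → Set
  H ⊆ G = ∀ u v → Adj H u v → Adj G u v

  ∅ : Graph n
  ∅ = record { adj = λ _ _ → false ; adj-sym = λ _ _ → refl ; no-loop = λ _ → refl }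

  deg : Graph n → Fin n → ℕ
  deg H v = ∣ tabulate (adj H v) ∣

  Connected : Graph n → Fin n → Fin n → Set
  Connected H = Star (Adj H)

  private

    -- Warshall's algorithm: u reaches v using only intermediate vertices in xs.
    Via : Graph n → List (Fin n) → Fin n → Fin n → Set
    Via H []       u v = u ≡ v ⊎ Adj H u v
    Via H (x ∷ xs) u v = Via H xs u v ⊎ (Via H xs u x × Via H xs x v)

    via? : ∀ H xs u v → Dec (Via H xs u v)
    via? H []       u v = (u Fin.≟ v) ⊎-dec T? (adj H u v)
    via? H (x ∷ xs) u v = via? H xs u v ⊎-dec (via? H xs u x ×-dec via? H xs x v)

    via-sound : ∀ H xs {u v} → Via H xs u v → Connected H u v
    via-sound H []       (inj₁ refl)    = ε
    via-sound H []       (inj₂ e)       = e ◅ ε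
    via-sound H (x ∷ xs) (inj₁ p)       = via-sound H xs p
    via-sound H (x ∷ xs) (inj₂ (p , q)) = via-sound H xs p ◅◅ via-sound H xs q

    via-base : ∀ H xs {u v} → u ≡ v ⊎ Adj H u v → Via H xs u v
    via-base H []       b = b
    via-base H (x ∷ xs) b = inj₁ (via-base H xs b)

    into : ∀ H x xs {u} → Via H (x ∷ xs) u x → Via H xs u x
    into H x xs (inj₁ p)       = p
    into H x xs (inj₂ (p , _)) = p

    from : ∀ H x xs {v} → Via H (x ∷ xs) x v → Via H xs x v
    from H x xs (inj₁ p)       = p
    from H x xs (inj₂ (_ , p)) = p

    via-trans : ∀ H xs {x u v} → x ∈ xs → Via H xs u x → Via H xs x v → Via H xs u v
    via-trans H (y ∷ ys) (here refl) p q = inj₂ (into H y ys p , from H y ys q)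
    via-trans H (y ∷ ys) (there x∈) (inj₁ p)       (inj₁ q)       = inj₁ (via-trans H ys x∈ p q)
    via-trans H (y ∷ ys) (there x∈) (inj₁ p)       (inj₂ (q , r)) = inj₂ (via-trans H ys x∈ p q , r)
    via-trans H (y ∷ ys) (there x∈) (inj₂ (o , p)) (inj₁ q)       = inj₂ (o , via-trans H ys x∈ p q)
    via-trans H (y ∷ ys) (there x∈) (inj₂ (o , _)) (inj₂ (_ , r)) = inj₂ (o , r)

    via-complete : ∀ H {u v} → Connected H u v → Via H (allFin n) u v
    via-complete H ε       = via-base H (allFin n) (inj₁ refl)
    via-complete H (_◅_ {j = j} e p) =
      via-trans H (allFin n) (∈-allFin j) (via-base H (allFin n) (inj₂ e)) (via-complete H p)

  connected? : ∀ H u v → Dec (Connected H u v)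
  connected? H u v = map′ (via-sound H (allFin n)) (via-complete H) (via? H (allFin n) u v)

  module _ {R : Fin n → Fin n → Set} where

    vertices : ∀ {s t} → Star R s t → List (Fin n)
    vertices {s} ε       = s ∷ []
    vertices {s} (_ ◅ w) = s ∷ vertices w

    edges : ∀ {s t} → Star R s t → List (Fin n × Fin n)
    edges ε                     = []
    edges {s} (_◅_ {j = u} _ w) = (s , u) ∷ edges w

  record Path (G : Graph n) (s t : Fin n) : Set where
    field
      walk   : Star (Adj G) s t
      simple : Unique (vertices walk)

  open Path public

  -- The extension part P*: the edges of P whose ends are not connected in H.
  -- A simple path repeats no edge, so the list counts each edge once.
  extension : ∀ {G s t} → Graph n → Path G s t → List (Fin n × Fin n)
  extension H P = filter (λ e → ¬? (connected? H (proj₁ e) (proj₂ e))) (edges (walk P))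

  open import Data.List.Membership.DecPropositional (Product.≡-dec (Fin._≟_ {n}) (λ {_} → Fin._≟_ {n})) using (_∈?_)

  among : List (Fin n × Fin n) → Fin n → Fin n → Bool
  among es u v = ⌊ (u , v) ∈? es ⌋ ∨ ⌊ (v , u) ∈? es ⌋

  private

    among-no-loop : ∀ {es v} → ¬ (v , v) ∈ es → among es v v ≡ false
    among-no-loop {es} {v} v∉ with (v , v) ∈? es
    ... | yes v∈ = contradiction v∈ v∉
    ... | no _   = refl

  -- H ∪ P*
  augment : ∀ {G s t} → Graph n → Path G s t → Graph n
  augment H P = record
    { adj     = λ u v → adj H u v ∨ among (extension H P) u v
    ; adj-sym = λ u v → cong₂ _∨_ (adj-sym H u v) (∨-comm ⌊ (u , v) ∈? extension H P ⌋ ⌊ (v , u) ∈? extension H P ⌋)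
    ; no-loop = λ v → cong₂ _∨_ (no-loop H v) (among-no-loop λ v∈ →
        proj₂ (∈-filter⁻ (λ e → ¬? (connected? H (proj₁ e) (proj₂ e))) {xs = edges (walk P)} v∈) ε)
    }

data Bound : Set where
  finite : (x : ℝ) → 0ᴿ <ᴿ x → Bound
  ∞      : Bound

_÷_ : ℕ → Bound → ℝ
d ÷ finite x 0<x = fromℕ d *ᴿ inv x 0<x
d ÷ ∞            = 0ᴿ

endpoints : {A : Set} → List (A × A) → List A
endpoints = concatMap λ d → proj₁ d ∷ proj₂ d ∷ []

module _ {n : ℕ} (b : Fin n → Bound) where

  load : Graph n → Fin n → ℝ
  load H v = deg H v ÷ b v

  -- Loads are nonnegative, so starting the maximum at 0 is harmless.
  maxLoad : Graph n → ℝ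
  maxLoad H = foldr _⊔ᴿ_ 0ᴿ (map (load H) (allFin n))

  uptick : Graph n → Fin n → ℝ
  uptick H v = load H v +ᴿ (2 ÷ b v)

  upticks : Graph n → List (Fin n × Fin n) → ℝ
  upticks H es = foldr _⊔ᴿ_ 0ᴿ (map (uptick H) (endpoints es))

module _ {n : ℕ} (G : Graph n) (b : Fin n → Bound) where

  -- Ties are broken by the number of edges of P*, i.e. paths are measured
  -- after contracting the components of H. If edges inside components counted
  -- too, a path zigzagging between two components could beat one following
  -- them, H would acquire cycles, and the O(log n) bound would be false.
  record Greedy {s t : Fin n} (H : Graph n) (P : Path G s t) : Set where
    field
      minimal : ∀ (Q : Path G s t) → upticks b H (extension H P) ≤ᴿ upticks b H (extension H Q)
      fewest  : ∀ (Q : Path G s t) → upticks b H (extension H Q) ≈ᴿ upticks b H (extension H P) →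
                length (extension H P) ℕ.≤ length (extension H Q)

  -- Run H ds H′: serving the demands ds in order, starting from H, can end
  -- with H′ (ties left open by Greedy are resolved arbitrarily).
  data Run : Graph n → List (Fin n × Fin n) → Graph n → Set where
    done  : ∀ {H} → Run H [] H
    serve : ∀ {H H′ s t ds} (P : Path G s t) → Greedy H P →
            Run (augment H P) ds H′ → Run H ((s , t) ∷ ds) H′

  GA : List (Fin n × Fin n) → Graph n → Set
  GA = Run ∅

  Feasible : List (Fin n × Fin n) → Graph n → Set
  Feasible ds H = H ⊆ G × All (λ d → Connected H (proj₁ d) (proj₂ d)) ds

  -- x = min { max_v ℓ_H(v) : H feasible }
  IsOPT : List (Fin n × Fin n) → ℝ → Set
  IsOPT ds x = (∃ λ H → Feasible ds H × maxLoad b H ≈ᴿ x)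
             × (∀ H → Feasible ds H → x ≤ᴿ maxLoad b H)

{-# OPTIONS --safe #-}

-- Fix an optimal subgraph H*. For a threshold r, mark the demands that GA
-- serves with ℓ⁺(P*) > r, and call a vertex heavy if its final uptick load
-- exceeds r.
--
-- (1) The number of marked demands is at most Σ deg_{H*}(v) over heavy v: the
-- two ends of a marked demand cannot be joined by earlier components and edges
-- between non-heavy vertices, so every marked demand merges two classes, each
-- of which H* leaves through an edge into a heavy vertex.
-- (2) For every vertex set S, marked demands add at most 2|S| + 2·#marked to
-- the total degree of S: a greedy path enters and leaves each component of H
-- at most once, and all components it meets become one.
--
-- A vertex heavy for r + 8·OPT receives at least 8·deg_{H*}(v) − 2 of its
-- degree from demands marked for r. Applying (2) to these vertices and then (1)
-- for r + 8·OPT shows that raising r by 8·OPT at least halves the number of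
-- marked demands; there are at most n/2 demands, so none is marked for
-- r = 8·⌊log₂ n⌋·OPT, which then bounds all loads.
--
-- Comparisons of reals are undecidable, but _≤ᴿ_ is stable under double
-- negation, so the finitely many case distinctions above may be made.
module Submission where

open import Defs
open import Data.Bool.Base using (true; false; T; if_then_else_)
open import Data.Bool.Properties using (T-∨)
open import Data.Fin.Base using (Fin; zero; suc)
import Data.Fin.Properties as Fin
open import Data.Fin.Subset using (∣_∣)
import Data.Integer.Base as ℤ
import Data.Integer.Properties as ℤ
open import Data.List.Base using (List; []; _∷_; _++_; map; concatMap; length; allFin; filter; tabulate; foldr)
open import Data.List.Membership.DecPropositional using () renaming (_∈?_ to mem?)
open import Data.List.Membership.Propositional using (_∈_)
open import Data.List.Membership.Propositional.Properties using (∈-allFin; ∈-filter⁻; ∈-filter⁺; ∈-++⁺ˡ; ∈-++⁺ʳ; ∈-concat⁺′; ∈-map⁺)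
open import Data.List.Properties using (length-++; length-tabulate; filter-accept; filter-reject)
open import Data.List.Relation.Binary.Sublist.Propositional using ([]; _∷_; _∷ʳ_; ⊆-refl; ⊆-trans; ⊆-reflexive) renaming (_⊆_ to _⊑_)
open import Data.List.Relation.Binary.Sublist.Propositional.Properties using (filter⁺; length-mono-≤)
open import Data.List.Relation.Unary.All as All using (All; []; _∷_)
open import Data.List.Relation.Unary.All.Properties using (¬Any⇒All¬)
open import Data.List.Relation.Unary.AllPairs using (AllPairs; []; _∷_)
open import Data.List.Relation.Unary.Any using (here; there)
open import Data.List.Relation.Unary.Unique.Propositional using (Unique)
import Data.List.Relation.Unary.Unique.Propositional.Properties as Unique
open import Data.Nat.Base as ℕ using (ℕ; zero; suc; _≤_; s≤s; z≤n)
open import Data.Nat.ListAction using (sum)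
open import Data.Nat.Logarithm using (⌊log₂_⌋; ⌊log₂⌋-mono-≤; ⌊log₂[2^n]⌋≡n)
import Data.Nat.Properties as ℕ
open import Data.Nat.Solver using () renaming (module +-*-Solver to ℕ-Solver)
open import Data.Product.Base using (∃; _×_; _,_; proj₁; proj₂)
import Data.Product.Properties as Product
open import Data.Rational.Base as ℚ using (ℚ; 0ℚ; 1ℚ; ½; _+_; _*_; _-_; -_; _<_; positive; nonNegative) renaming (∣_∣ to abs)
open import Data.Rational.Properties as ℚ using (module ≤-Reasoning)
open import Data.Rational.Solver using () renaming (module +-*-Solver to ℚ-Solver)
open import Data.Rational.Unnormalised.Base as ℚᵘ using (mkℚᵘ; *≡*; *≤*)
import Data.Rational.Unnormalised.Properties as ℚᵘ
open import Data.Sum.Base as Sum using (_⊎_; inj₁; inj₂)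
import Data.Vec.Base as Vec
open import Function.Base using (_∘_; case_of_)
open import Function.Bundles using (Equivalence)
open import Relation.Binary.Construct.Closure.ReflexiveTransitive as Star using (Star; ε; _◅_; _◅◅_)
open import Relation.Binary.PropositionalEquality using (_≡_; _≢_; refl; sym; trans; cong; cong₂; subst; subst₂; module ≡-Reasoning)
open import Relation.Nullary using (¬_; Dec; yes; no; contradiction)
open import Relation.Nullary.Decidable using (⌊_⌋; ¬?; T?; _×-dec_; toWitness; fromWitness; decidable-stable; ¬¬-excluded-middle)

-- Real numbers

private
  variable
    x y z w : ℝ

ι : ℕ → ℚ
ι n = ℤ.+ n ℚ./ 1

fromℚᵘ-mono-≤ : ∀ {p q} → p ℚᵘ.≤ q → ℚ.fromℚᵘ p ℚ.≤ ℚ.fromℚᵘ q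
fromℚᵘ-mono-≤ {p} {q} p≤q = ℚ.toℚᵘ-cancel-≤ (ℚᵘ.≤-respˡ-≃ (ℚᵘ.≃-sym (ℚ.toℚᵘ-fromℚᵘ p))
  (ℚᵘ.≤-respʳ-≃ (ℚᵘ.≃-sym (ℚ.toℚᵘ-fromℚᵘ q)) p≤q))

ι-mono : ∀ {m n} → m ℕ.≤ n → ι m ℚ.≤ ι n
ι-mono {m} {n} m≤n = fromℚᵘ-mono-≤ {mkℚᵘ (ℤ.+ m) 0} {mkℚᵘ (ℤ.+ n) 0} (*≤* (ℤ.*-monoʳ-≤-nonNeg (ℤ.+ 1) (ℤ.+≤+ m≤n)))

0≤ι : ∀ n → 0ℚ ℚ.≤ ι n
0≤ι n = ι-mono {0} {n} z≤n

ι-+ : ∀ m n → ι (m ℕ.+ n) ≡ ι m + ι n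
ι-+ m n = ℚ.toℚᵘ-injective (begin
  ℚ.toℚᵘ (ι (m ℕ.+ n))                  ≈⟨ ℚ.toℚᵘ-fromℚᵘ (mkℚᵘ (ℤ.+ (m ℕ.+ n)) 0) ⟩
  mkℚᵘ (ℤ.+ (m ℕ.+ n)) 0                ≈⟨ *≡* (cong (ℤ._* ℤ.+ 1) (sym (cong₂ ℤ._+_ (ℤ.*-identityʳ (ℤ.+ m)) (ℤ.*-identityʳ (ℤ.+ n))))) ⟩
  mkℚᵘ (ℤ.+ m) 0 ℚᵘ.+ mkℚᵘ (ℤ.+ n) 0    ≈⟨ ℚᵘ.+-cong (ℚ.toℚᵘ-fromℚᵘ (mkℚᵘ (ℤ.+ m) 0)) (ℚ.toℚᵘ-fromℚᵘ (mkℚᵘ (ℤ.+ n) 0)) ⟨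
  ℚ.toℚᵘ (ι m) ℚᵘ.+ ℚ.toℚᵘ (ι n)        ≈⟨ ℚ.toℚᵘ-homo-+ (ι m) (ι n) ⟨
  ℚ.toℚᵘ (ι m + ι n)                    ∎)
  where open import Relation.Binary.Reasoning.Setoid ℚᵘ.≃-setoid

+½+½ : ∀ a δ → a + ½ * δ + ½ * δ ≡ a + δ
+½+½ a δ = trans (ℚ.+-assoc a (½ * δ) (½ * δ))
  (cong (a +_) (trans (sym (ℚ.*-distribʳ-+ δ ½ ½)) (ℚ.*-identityˡ δ)))

0<* : ∀ {p q} → 0ℚ < p → 0ℚ < q → 0ℚ < p * q
0<* {p} {q} 0<p 0<q = subst (_< p * q) (ℚ.*-zeroʳ p)
  (ℚ.*-monoʳ-<-pos p {{positive 0<p}} 0<q)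

0≤* : ∀ {p q} → 0ℚ ℚ.≤ p → 0ℚ ℚ.≤ q → 0ℚ ℚ.≤ p * q
0≤* {p} {q} 0≤p 0≤q = subst (ℚ._≤ p * q) (ℚ.*-zeroʳ p)
  (ℚ.*-monoˡ-≤-nonNeg p {{nonNegative 0≤p}} 0≤q)

0<½* : ∀ {δ} → 0ℚ < δ → 0ℚ < ½ * δ
0<½* = 0<* (ℚ.positive⁻¹ ½)

≤+ : ∀ {p q δ} → 0ℚ < δ → p ℚ.≤ q → p ℚ.≤ q + δ
≤+ {q = q} 0<δ p≤q = ℚ.≤-trans p≤q
  (subst (ℚ._≤ q + _) (ℚ.+-identityʳ q) (ℚ.+-monoʳ-≤ q (ℚ.<⇒≤ 0<δ)))

infix 4 _≼_

-- _≤ᴿ_ unfolds to a Π-type from which unification cannot recover x and y; the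
-- record keeps them visible.
record _≼_ (x y : ℝ) : Set where
  constructor ≤ᴿ⇒≼
  field ≼⇒≤ᴿ : x ≤ᴿ y

open _≼_

eventually : ∀ N → (∀ {n} → N ℕ.≤ n → seq x n ℚ.≤ seq y n) → x ≼ y
eventually N x≤y = ≤ᴿ⇒≼ λ δ 0<δ → N , λ N≤n → ≤+ 0<δ (x≤y N≤n)

pointwise : (∀ n → seq x n ℚ.≤ seq y n) → x ≼ y
pointwise x≤y = eventually 0 λ {n} _ → x≤y n

≼-refl : x ≼ x
≼-refl = pointwise λ _ → ℚ.≤-refl

≼-trans : x ≼ y → y ≼ z → x ≼ z
≼-trans {x} {y} {z} (≤ᴿ⇒≼ x≤y) (≤ᴿ⇒≼ y≤z) = ≤ᴿ⇒≼ λ δ 0<δ →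
  let (M , h) = x≤y (½ * δ) (0<½* 0<δ)
      (N , k) = y≤z (½ * δ) (0<½* 0<δ)
  in M ℕ.⊔ N , λ {n} p → begin
    seq x n                      ≤⟨ h (ℕ.m⊔n≤o⇒m≤o M N p) ⟩
    seq y n + ½ * δ              ≤⟨ ℚ.+-monoˡ-≤ (½ * δ) (k (ℕ.m⊔n≤o⇒n≤o M N p)) ⟩
    seq z n + ½ * δ + ½ * δ      ≡⟨ +½+½ (seq z n) δ ⟩
    seq z n + δ                  ∎
  where open ≤-Reasoning

+ᴿ-mono-≼ : x ≼ y → z ≼ w → x +ᴿ z ≼ y +ᴿ w
+ᴿ-mono-≼ {x} {y} {z} {w} (≤ᴿ⇒≼ x≤y) (≤ᴿ⇒≼ z≤w) = ≤ᴿ⇒≼ λ δ 0<δ →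
  let (M , h) = x≤y (½ * δ) (0<½* 0<δ)
      (N , k) = z≤w (½ * δ) (0<½* 0<δ)
  in M ℕ.⊔ N , λ {n} p → begin
    seq x n + seq z n                        ≤⟨ ℚ.+-mono-≤ (h (ℕ.m⊔n≤o⇒m≤o M N p)) (k (ℕ.m⊔n≤o⇒n≤o M N p)) ⟩
    (seq y n + ½ * δ) + (seq w n + ½ * δ)    ≡⟨ solve 3 (λ a b d → (a :+ d) :+ (b :+ d) := (a :+ b) :+ d :+ d) refl (seq y n) (seq w n) (½ * δ) ⟩
    (seq y n + seq w n) + ½ * δ + ½ * δ      ≡⟨ +½+½ (seq y n + seq w n) δ ⟩
    (seq y n + seq w n) + δ                  ∎
  where
  open ≤-Reasoning
  open ℚ-Solver

x≼x⊔y : ∀ x y → x ≼ x ⊔ᴿ y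
x≼x⊔y x y = pointwise λ n → ℚ.p≤p⊔q (seq x n) (seq y n)

y≼x⊔y : ∀ x y → y ≼ x ⊔ᴿ y
y≼x⊔y x y = pointwise λ n → ℚ.p≤q⊔p (seq x n) (seq y n)

⊔ᴿ-lub : x ≼ z → y ≼ z → x ⊔ᴿ y ≼ z
⊔ᴿ-lub (≤ᴿ⇒≼ x≤z) (≤ᴿ⇒≼ y≤z) = ≤ᴿ⇒≼ λ δ 0<δ →
  let (M , h) = x≤z δ 0<δ
      (N , k) = y≤z δ 0<δ
  in M ℕ.⊔ N , λ p → ℚ.⊔-lub (h (ℕ.m⊔n≤o⇒m≤o M N p)) (k (ℕ.m⊔n≤o⇒n≤o M N p))

p≤∣p∣ : ∀ p → p ℚ.≤ abs p
p≤∣p∣ p with ℚ.≤-total 0ℚ p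
... | inj₁ 0≤p = ℚ.≤-reflexive (sym (ℚ.0≤p⇒∣p∣≡p 0≤p))
... | inj₂ p≤0 = ℚ.≤-trans p≤0 (ℚ.nonNegative⁻¹ (abs p) {{ℚ.∣-∣-nonNeg p}})

cauchy-≤ : ∀ x δ → 0ℚ < δ → ∃ λ N → ∀ {m n} → N ℕ.≤ m → N ℕ.≤ n → seq x m ℚ.≤ seq x n + δ
cauchy-≤ x δ 0<δ =
  let (N , h) = cauchy x δ 0<δ
  in N , λ {m} {n} p q → begin
    seq x m                        ≡⟨ solve 2 (λ p q → p := q :+ (p :- q)) refl (seq x m) (seq x n) ⟩
    seq x n + (seq x m - seq x n)  ≤⟨ ℚ.+-monoʳ-≤ (seq x n) (ℚ.≤-trans (p≤∣p∣ (seq x m - seq x n)) (ℚ.<⇒≤ (h p q))) ⟩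
    seq x n + δ                    ∎
  where
  open ≤-Reasoning
  open ℚ-Solver

-- The Cauchy moduli make it decidable up to ε whether x ≤ y, so only a
-- refutation of y < x is needed.
≼-stable : ¬ ¬ x ≼ y → x ≼ y
≼-stable {x} {y} ¬¬x≼y = ≤ᴿ⇒≼ λ δ 0<δ → K δ 0<δ , close δ 0<δ
  where
  open ≤-Reasoning
  open ℚ-Solver
  module _ (δ : ℚ) (0<δ : 0ℚ < δ) where
    η ζ : ℚ
    η = ½ * δ
    -- A quarter of `η`, hence an eighth of `δ`: `far` closes with four errors `ζ` adding up to `η`,
    -- and `close` needs `ζ + ζ + η` to be at most `δ`.
    ζ = ½ * (½ * η)
    0<η : 0ℚ < η
    0<η = 0<½* 0<δ
    0<½η : 0ℚ < ½ * η
    0<½η = 0<½* 0<η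
    0<ζ : 0ℚ < ζ
    0<ζ = 0<½* 0<½η
    cx = cauchy-≤ x ζ 0<ζ
    cy = cauchy-≤ y ζ 0<ζ
    K : ℕ
    K = proj₁ cx ℕ.⊔ proj₁ cy
    Kx : ∀ {n} → K ℕ.≤ n → proj₁ cx ℕ.≤ n
    Kx = ℕ.m⊔n≤o⇒m≤o (proj₁ cx) (proj₁ cy)
    Ky : ∀ {n} → K ℕ.≤ n → proj₁ cy ℕ.≤ n
    Ky = ℕ.m⊔n≤o⇒n≤o (proj₁ cx) (proj₁ cy)
    far : seq y K + η < seq x K → ¬ x ≼ y
    far lt (≤ᴿ⇒≼ x≤y) =
      let (N , h) = x≤y ζ 0<ζ
          n = K ℕ.⊔ N
          K≤n = ℕ.m≤m⊔n K N
      in ℚ.<-irrefl refl (begin-strict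
        seq y K + η                 <⟨ lt ⟩
        seq x K                     ≤⟨ proj₂ cx (Kx ℕ.≤-refl) (Kx K≤n) ⟩
        seq x n + ζ                 ≤⟨ ℚ.+-monoˡ-≤ ζ (h (ℕ.m≤n⊔m K N)) ⟩
        seq y n + ζ + ζ             ≡⟨ +½+½ (seq y n) (½ * η) ⟩
        seq y n + ½ * η             ≤⟨ ℚ.+-monoˡ-≤ (½ * η) (ℚ.≤-trans (proj₂ cy (Ky K≤n) (Ky ℕ.≤-refl)) (≤+ 0<ζ ℚ.≤-refl)) ⟩
        seq y K + ζ + ζ + ½ * η     ≡⟨ cong (_+ ½ * η) (+½+½ (seq y K) (½ * η)) ⟩
        seq y K + ½ * η + ½ * η     ≡⟨ +½+½ (seq y K) η ⟩
        seq y K + η                 ∎)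
    -- At the single index `K` this compares two rationals, which is decidable, so the double
    -- negation can be removed here.
    near : seq x K ℚ.≤ seq y K + η
    near = ℚ.≮⇒≥ λ lt → ¬¬x≼y (far lt)
    close : ∀ {n} → K ℕ.≤ n → seq x n ℚ.≤ seq y n + δ
    close {n} K≤n = begin
      seq x n                     ≤⟨ proj₂ cx (Kx K≤n) (Kx ℕ.≤-refl) ⟩
      seq x K + ζ                 ≤⟨ ℚ.+-monoˡ-≤ ζ near ⟩
      seq y K + η + ζ             ≤⟨ ℚ.+-monoˡ-≤ ζ (ℚ.+-monoˡ-≤ η (proj₂ cy (Ky ℕ.≤-refl) (Ky K≤n))) ⟩
      seq y n + ζ + η + ζ         ≡⟨ solve 3 (λ a z e → a :+ z :+ e :+ z := a :+ z :+ z :+ e) refl (seq y n) ζ η ⟩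
      seq y n + ζ + ζ + η         ≡⟨ cong (_+ η) (+½+½ (seq y n) (½ * η)) ⟩
      seq y n + ½ * η + η         ≤⟨ ℚ.+-monoˡ-≤ η (≤+ {p = seq y n + ½ * η} 0<½η ℚ.≤-refl) ⟩
      seq y n + ½ * η + ½ * η + η ≡⟨ cong (_+ η) (+½+½ (seq y n) η) ⟩
      seq y n + η + η             ≡⟨ +½+½ (seq y n) δ ⟩
      seq y n + δ                 ∎

recip-nonNeg : ∀ {q} → 0ℚ < q → 0ℚ ℚ.≤ recip q
recip-nonNeg {q} 0<q with q ℚ.≟ 0ℚ
... | yes _  = ℚ.≤-refl
... | no q≢0 = ℚ.<⇒≤ (ℚ.positive⁻¹ _ {{ℚ.1/pos⇒pos q {{positive 0<q}}}})

÷-mono-≼ : ∀ {m n} b → m ℕ.≤ n → m ÷ b ≼ n ÷ b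
÷-mono-≼ ∞ _ = ≼-refl
-- Early terms of `x` may be zero or negative; from `N` on they are at least `β`, and only then is
-- the reciprocal known to be nonnegative.
÷-mono-≼ {m} {n} (finite x (β , 0<β , N , β≤)) m≤n = eventually N λ {k} N≤k →
  ℚ.*-monoʳ-≤-nonNeg (recip (seq x k))
    {{nonNegative (recip-nonNeg (ℚ.<-≤-trans 0<β (subst (ℚ._≤ seq x k) (ℚ.+-identityˡ β) (β≤ N≤k))))}}
    (ι-mono {m} {n} m≤n)

÷-+ : ∀ m n b → ((m ℕ.+ n) ÷ b ≼ m ÷ b +ᴿ n ÷ b) × (m ÷ b +ᴿ n ÷ b ≼ (m ℕ.+ n) ÷ b)
÷-+ m n ∞ = pointwise (λ _ → ℚ.≤-refl) , pointwise (λ _ → ℚ.≤-refl)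
÷-+ m n (finite x _) =
  pointwise (λ k → ℚ.≤-reflexive (eq (recip (seq x k)))) ,
  pointwise (λ k → ℚ.≤-reflexive (sym (eq (recip (seq x k)))))
  where
  eq : ∀ u → ι (m ℕ.+ n) * u ≡ ι m * u + ι n * u
  eq u = trans (cong (_* u) (ι-+ m n)) (ℚ.*-distribʳ-+ u (ι m) (ι n))

0÷≼0 : ∀ b → 0 ÷ b ≼ 0ᴿ
0÷≼0 ∞            = ≼-refl
0÷≼0 (finite x _) = pointwise λ k → ℚ.≤-reflexive (ℚ.*-zeroˡ (recip (seq x k)))

infixr 8 _×ᴿ_

-- Repeated addition instead of a product with `fromℕ k`: thresholds can then be raised by
-- induction, using only monotonicity of `_+ᴿ_`.
_×ᴿ_ : ℕ → ℝ → ℝ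
zero  ×ᴿ x = 0ᴿ
suc k ×ᴿ x = x +ᴿ k ×ᴿ x

seq-×ᴿ : ∀ k x n → seq (k ×ᴿ x) n ≡ ι k * seq x n
seq-×ᴿ zero    x n = sym (ℚ.*-zeroˡ (seq x n))
seq-×ᴿ (suc k) x n = begin
  seq x n + seq (k ×ᴿ x) n      ≡⟨ cong₂ _+_ (sym (ℚ.*-identityˡ (seq x n))) (seq-×ᴿ k x n) ⟩
  1ℚ * seq x n + ι k * seq x n  ≡⟨ ℚ.*-distribʳ-+ (seq x n) 1ℚ (ι k) ⟨
  (1ℚ + ι k) * seq x n          ≡⟨ cong (_* seq x n) (ι-+ 1 k) ⟨
  ι (suc k) * seq x n           ∎
  where open ≡-Reasoning

×ᴿ-nonNeg : ∀ k → 0ᴿ ≼ x → 0ᴿ ≼ k ×ᴿ x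
×ᴿ-nonNeg zero    0≤x = ≼-refl
×ᴿ-nonNeg (suc k) 0≤x = ≼-trans (pointwise λ _ → ℚ.≤-refl) (+ᴿ-mono-≼ 0≤x (×ᴿ-nonNeg k 0≤x))

-- Used with `i = 8`, where `h` is the degree of a vertex in the optimum and `m` a degree whose load
-- respects the old threshold `k ×ᴿ x`.
÷-×ᴿ : ∀ {m h k} b i → h ÷ b ≼ x → m ÷ b ≼ k ×ᴿ x → (i ℕ.* h ℕ.+ m) ÷ b ≼ (i ℕ.+ k) ×ᴿ x
÷-×ᴿ b zero h≤ m≤ = m≤
÷-×ᴿ {x} {m} {h} {k} b (suc i) h≤ m≤ = subst (λ a → a ÷ b ≼ (suc i ℕ.+ k) ×ᴿ x) (sym (ℕ.+-assoc h (i ℕ.* h) m))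
  (≼-trans (proj₁ (÷-+ h (i ℕ.* h ℕ.+ m) b)) (+ᴿ-mono-≼ h≤ (÷-×ᴿ b i h≤ m≤)))

-- Powers of two and the real logarithm

dyadic : ∀ n → ∃ λ L → 2 ℕ.^ L ℕ.≤ suc n × suc n ℕ.< 2 ℕ.^ suc L
dyadic zero = 0 , s≤s z≤n , s≤s (s≤s z≤n)
dyadic (suc n) with dyadic n
... | L , lo , hi with suc (suc n) ℕ.<? 2 ℕ.^ suc L
... | yes lt = L , ℕ.m≤n⇒m≤1+n lo , lt
... | no ≮   = suc L , ℕ.≮⇒≥ ≮ , ℕ.≤-<-trans hi (ℕ.^-monoʳ-< 2 (s≤s (s≤s z≤n)) (ℕ.n<1+n (suc L)))

module _ {n L : ℕ} where

  ⌊log₂^⌋-lower : 2 ℕ.^ L ℕ.≤ n → ∀ k → L ℕ.* k ℕ.≤ ⌊log₂ n ℕ.^ k ⌋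
  ⌊log₂^⌋-lower lo k = subst (ℕ._≤ ⌊log₂ n ℕ.^ k ⌋) (⌊log₂[2^n]⌋≡n (L ℕ.* k))
    (⌊log₂⌋-mono-≤ (subst (ℕ._≤ n ℕ.^ k) (ℕ.^-*-assoc 2 L k) (ℕ.^-monoˡ-≤ k lo)))

  ⌊log₂^⌋-upper : n ℕ.≤ 2 ℕ.^ L → ∀ k → ⌊log₂ n ℕ.^ k ⌋ ℕ.≤ L ℕ.* k
  ⌊log₂^⌋-upper hi k = subst (⌊log₂ n ℕ.^ k ⌋ ℕ.≤_) (⌊log₂[2^n]⌋≡n (L ℕ.* k))
    (⌊log₂⌋-mono-≤ (subst (n ℕ.^ k ℕ.≤_) (ℕ.^-*-assoc 2 L k) (ℕ.^-monoˡ-≤ k hi)))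

-- The hypothesis passes to all powers of `suc n`, so every single term of the defining sequence
-- obeys the bound, not only its limit.
seq-log₂-lower : ∀ {n L} → 2 ℕ.^ L ℕ.≤ suc n → ∀ k → ι L ℚ.≤ seq (log₂ (suc n)) k
seq-log₂-lower {n} {L} lo k = fromℚᵘ-mono-≤ {mkℚᵘ (ℤ.+ L) 0} {mkℚᵘ (ℤ.+ ⌊log₂ suc n ℕ.^ suc k ⌋) k} (*≤* (subst₂ ℤ._≤_ (ℤ.pos-* L (suc k)) (sym (ℤ.*-identityʳ _))
  (ℤ.+≤+ (⌊log₂^⌋-lower {suc n} {L} lo (suc k)))))

seq-log₂-upper : ∀ {n L} → suc n ℕ.≤ 2 ℕ.^ L → ∀ k → seq (log₂ (suc n)) k ℚ.≤ ι L
seq-log₂-upper {n} {L} hi k = fromℚᵘ-mono-≤ {mkℚᵘ (ℤ.+ ⌊log₂ suc n ℕ.^ suc k ⌋) k} {mkℚᵘ (ℤ.+ L) 0} (*≤* (subst₂ ℤ._≤_ (sym (ℤ.*-identityʳ _)) (ℤ.pos-* L (suc k))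
  (ℤ.+≤+ (⌊log₂^⌋-upper {suc n} {L} hi (suc k)))))

-- A nonnegative real may have slightly negative terms `q`, so multiplying `ι L ≤ l` by `q` is not
-- allowed termwise. Multiplying `0 ≤ l - ι L` by `q + η` is, eventually; the error is at most
-- `8 * η = δ` because `l - ι L` is at most 1.
×ᴿ≼log₂ : ∀ {n L} → 2 ℕ.^ L ℕ.≤ suc n → suc n ℕ.< 2 ℕ.^ suc L → 0ᴿ ≼ x →
          (L ℕ.* 8) ×ᴿ x ≼ fromℕ 8 *ᴿ log₂ (suc n) *ᴿ x
×ᴿ≼log₂ {x} {n} {L} lo hi (≤ᴿ⇒≼ 0≤x) = ≤ᴿ⇒≼ λ δ 0<δ → proj₁ (ev δ 0<δ) , λ {k} p → close δ 0<δ k (proj₂ (ev δ 0<δ) p)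
  where
  open ≤-Reasoning
  open ℚ-Solver
  module _ (δ : ℚ) (0<δ : 0ℚ < δ) where
    e η : ℚ
    e = ℤ.+ 1 ℚ./ 8
    η = e * δ
    ev : ∃ λ N → ∀ {k} → N ℕ.≤ k → 0ℚ ℚ.≤ seq x k + η
    ev = 0≤x η (0<* (ℚ.positive⁻¹ e) 0<δ)
    8η≡δ : ι 8 * η ≡ δ
    8η≡δ = trans (sym (ℚ.*-assoc (ι 8) e δ)) (ℚ.*-identityˡ δ)
    ι-*8 : ∀ L → ι (L ℕ.* 8) ≡ ι 8 * ι L
    ι-*8 zero    = refl
    ι-*8 (suc L) = trans (ι-+ 8 (L ℕ.* 8)) (trans (cong (ι 8 +_) (ι-*8 L))
      (trans (cong (_+ ι 8 * ι L) (sym (ℚ.*-identityʳ (ι 8))))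
        (trans (sym (ℚ.*-distribˡ-+ (ι 8) 1ℚ (ι L))) (cong (ι 8 *_) (sym (ι-+ 1 L))))))
    close : ∀ k → 0ℚ ℚ.≤ seq x k + η → seq ((L ℕ.* 8) ×ᴿ x) k ℚ.≤ ι 8 * seq (log₂ (suc n)) k * seq x k + δ
    close k 0≤q+η = begin
      seq ((L ℕ.* 8) ×ᴿ x) k           ≡⟨ trans (seq-×ᴿ (L ℕ.* 8) x k) (cong (_* q) (ι-*8 L)) ⟩
      ι 8 * ι L * q                    ≡⟨ ℚ.+-identityʳ (ι 8 * ι L * q) ⟨
      ι 8 * ι L * q + 0ℚ               ≤⟨ ℚ.+-monoʳ-≤ (ι 8 * ι L * q) (0≤* (0≤ι 8) (0≤* 0≤l-L 0≤q+η)) ⟩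
      ι 8 * ι L * q + ι 8 * ((l - ι L) * (q + η))
        ≡⟨ solve 5 (λ c L l q η → c :* L :* q :+ c :* ((l :- L) :* (q :+ η)) := c :* l :* q :+ c :* ((l :- L) :* η)) refl (ι 8) (ι L) l q η ⟩
      ι 8 * l * q + ι 8 * ((l - ι L) * η)
        ≤⟨ ℚ.+-monoʳ-≤ (ι 8 * l * q) (ℚ.*-monoˡ-≤-nonNeg (ι 8) (ℚ.*-monoʳ-≤-nonNeg η {{nonNegative 0≤η}} l-L≤1)) ⟩
      ι 8 * l * q + ι 8 * (1ℚ * η)     ≡⟨ cong (ι 8 * l * q +_) (trans (cong (ι 8 *_) (ℚ.*-identityˡ η)) 8η≡δ) ⟩
      ι 8 * l * q + δ                  ∎
      where
      q l : ℚ
      q = seq x k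
      l = seq (log₂ (suc n)) k
      0≤η : 0ℚ ℚ.≤ η
      0≤η = ℚ.<⇒≤ (0<* (ℚ.positive⁻¹ e) 0<δ)
      0≤l-L : 0ℚ ℚ.≤ l - ι L
      0≤l-L = subst (ℚ._≤ l - ι L) (ℚ.+-inverseʳ (ι L)) (ℚ.+-monoˡ-≤ (- ι L) (seq-log₂-lower {n} {L} lo k))
      l-L≤1 : l - ι L ℚ.≤ 1ℚ
      l-L≤1 = begin
        l - ι L              ≤⟨ ℚ.+-monoˡ-≤ (- ι L) (seq-log₂-upper {n} {suc L} (ℕ.<⇒≤ hi) k) ⟩
        ι (suc L) - ι L      ≡⟨ cong (_- ι L) (ι-+ 1 L) ⟩
        1ℚ + ι L - ι L       ≡⟨ solve 2 (λ o l → o :+ l :- l := o) refl 1ℚ (ι L) ⟩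
        1ℚ                   ∎

-- Lists and degrees

module _ {A : Set} where

  remove : ∀ {x : A} {xs} → x ∈ xs →
           ∃ λ ys → length xs ≡ suc (length ys) × (∀ {y} → y ∈ xs → y ≡ x ⊎ y ∈ ys)
  remove {xs = x ∷ xs} (here refl) = xs , refl , λ { (here p) → inj₁ p ; (there p) → inj₂ p }
  remove {xs = z ∷ xs} (there x∈) =
    let (ys , eq , split) = remove x∈
    in z ∷ ys , cong suc eq , λ { (here p) → inj₂ (here p) ; (there p) → Sum.map₂ there (split p) }

  unique-⊆⇒length≤ : ∀ {xs ys : List A} → Unique xs → (∀ {x} → x ∈ xs → x ∈ ys) → length xs ℕ.≤ length ys
  unique-⊆⇒length≤ [] _ = z≤n
  unique-⊆⇒length≤ {x ∷ xs} (x∉ ∷ u) sub =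
    let (zs , eq , split) = remove (sub (here refl))
    in subst (suc (length xs) ℕ.≤_) (sym eq) (s≤s (unique-⊆⇒length≤ u λ y∈ →
         Sum.[ (λ y≡x → contradiction (sym y≡x) (All.lookup x∉ y∈)) , (λ p → p) ] (split (sub (there y∈)))))

  ∑ : List A → (A → ℕ) → ℕ
  ∑ xs f = sum (map f xs)

  ∑-+ : ∀ xs (f g : A → ℕ) → ∑ xs (λ x → f x ℕ.+ g x) ≡ ∑ xs f ℕ.+ ∑ xs g
  ∑-+ []       f g = refl
  ∑-+ (x ∷ xs) f g = trans (cong (f x ℕ.+ g x ℕ.+_) (∑-+ xs f g))
    (solve 4 (λ a b c d → (a :+ b) :+ (c :+ d) := (a :+ c) :+ (b :+ d)) refl (f x) (g x) (∑ xs f) (∑ xs g))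
    where open ℕ-Solver

  ∑-mono : ∀ xs {f g : A → ℕ} → (∀ {x} → x ∈ xs → f x ℕ.≤ g x) → ∑ xs f ℕ.≤ ∑ xs g
  ∑-mono []       _   = z≤n
  ∑-mono (x ∷ xs) f≤g = ℕ.+-mono-≤ (f≤g (here refl)) (∑-mono xs (f≤g ∘ there))

  ∑-const : ∀ xs c → ∑ xs (λ _ → c) ≡ length xs ℕ.* c
  ∑-const []       c = refl
  ∑-const (x ∷ xs) c = cong (c ℕ.+_) (∑-const xs c)

  ∑-* : ∀ c xs (f : A → ℕ) → ∑ xs (λ x → c ℕ.* f x) ≡ c ℕ.* ∑ xs f
  ∑-* c []       f = sym (ℕ.*-zeroʳ c)
  ∑-* c (x ∷ xs) f = trans (cong (c ℕ.* f x ℕ.+_) (∑-* c xs f)) (sym (ℕ.*-distribˡ-+ c (f x) (∑ xs f)))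

  length-concatMap : ∀ {B : Set} (f : A → List B) xs → length (concatMap f xs) ≡ ∑ xs (length ∘ f)
  length-concatMap f []       = refl
  length-concatMap f (x ∷ xs) = trans (length-++ (f x)) (cong (length (f x) ℕ.+_) (length-concatMap f xs))

module _ {n : ℕ} where

  δ : Fin n → Fin n → ℕ
  δ v z = if ⌊ v Fin.≟ z ⌋ then 1 else 0

  count : Fin n → List (Fin n) → ℕ
  count v []       = 0
  count v (z ∷ zs) = δ v z ℕ.+ count v zs

  δ-≢ : ∀ {v z} → v ≢ z → δ v z ≡ 0
  δ-≢ {v} {z} v≢z with v Fin.≟ z
  ... | yes v≡z = contradiction v≡z v≢z
  ... | no _    = refl

  count≡0⊎∈ : ∀ v zs → count v zs ≡ 0 ⊎ v ∈ zs
  count≡0⊎∈ v [] = inj₁ refl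
  count≡0⊎∈ v (z ∷ zs) with v Fin.≟ z
  ... | yes v≡z = inj₂ (here v≡z)
  ... | no _    = Sum.map₂ there (count≡0⊎∈ v zs)

  count-unique : ∀ v {zs} → Unique zs → count v zs ℕ.≤ 1
  count-unique v [] = z≤n
  count-unique v {z ∷ zs} (z∉ ∷ u) with v Fin.≟ z
  ... | no _     = count-unique v u
  ... | yes refl with count≡0⊎∈ v zs
  ...   | inj₁ eq = s≤s (ℕ.≤-reflexive eq)
  ...   | inj₂ v∈ = contradiction refl (All.lookup z∉ v∈)

  count-filter : ∀ {A : Set} {P : A → Set} (P? : ∀ x → Dec (P x)) (f : A → Fin n) v xs →
                 count v (map f (filter P? xs)) ℕ.≤ count v (map f xs)
  count-filter P? f v [] = z≤n
  count-filter P? f v (x ∷ xs) with P? x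
  ... | yes _ = ℕ.+-monoʳ-≤ (δ v (f x)) (count-filter P? f v xs)
  ... | no _  = ℕ.≤-trans (count-filter P? f v xs) (ℕ.m≤n+m _ (δ v (f x)))

  count-endpoints : ∀ v es → count v (endpoints es) ≡ count v (map proj₁ es) ℕ.+ count v (map proj₂ es)
  count-endpoints v []             = refl
  count-endpoints v ((x , y) ∷ es) = trans (cong (λ c → δ v x ℕ.+ (δ v y ℕ.+ c)) (count-endpoints v es))
    (solve 4 (λ a b c d → a :+ (b :+ (c :+ d)) := (a :+ c) :+ (b :+ d)) refl
      (δ v x) (δ v y) (count v (map proj₁ es)) (count v (map proj₂ es)))
    where open ℕ-Solver

  ∑-δ-∉ : ∀ S {z} → ¬ z ∈ S → ∑ S (λ v → δ v z) ≡ 0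
  ∑-δ-∉ []      _  = refl
  ∑-δ-∉ (v ∷ S) z∉ = cong₂ ℕ._+_ (δ-≢ (λ v≡z → z∉ (here (sym v≡z)))) (∑-δ-∉ S (z∉ ∘ there))

  ∑-δ≤1 : ∀ {S} → Unique S → ∀ z → ∑ S (λ v → δ v z) ℕ.≤ 1
  ∑-δ≤1 [] z = z≤n
  ∑-δ≤1 {v ∷ S} (v∉ ∷ u) z with v Fin.≟ z
  ... | no _     = ∑-δ≤1 u z
  ... | yes refl = s≤s (ℕ.≤-reflexive (∑-δ-∉ S λ v∈ → All.lookup v∉ v∈ refl))

  neighbours : Graph n → Fin n → List (Fin n)
  neighbours H v = filter (λ u → T? (adj H v u)) (allFin n)

  deg≡length : ∀ H v → deg H v ≡ length (neighbours H v)
  deg≡length H v = go (λ u → u)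
    where
    go : ∀ {m} (g : Fin m → Fin n) →
         ∣ Vec.tabulate (adj H v ∘ g) ∣ ≡ length (filter (λ u → T? (adj H v u)) (tabulate g))
    go {zero}  g = refl
    go {suc m} g with adj H v (g zero)
    ... | true  = cong suc (go (g ∘ suc))
    ... | false = go (g ∘ suc)

  ∈-neighbours : ∀ H {u v} → Adj H v u → u ∈ neighbours H v
  ∈-neighbours H {u} {v} e = ∈-filter⁺ (λ u → T? (adj H v u)) (∈-allFin u) e

  deg≤length : ∀ H v {ys} → (∀ {u} → Adj H v u → u ∈ ys) → deg H v ℕ.≤ length ys
  deg≤length H v sub = subst (ℕ._≤ _) (sym (deg≡length H v))
    (unique-⊆⇒length≤ (Unique.filter⁺ (λ u → T? (adj H v u)) (Unique.allFin⁺ n))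
      λ u∈ → sub (proj₂ (∈-filter⁻ (λ u → T? (adj H v u)) {xs = allFin n} u∈)))

  Adj⇒1≤deg : ∀ H {u v} → Adj H v u → 1 ℕ.≤ deg H v
  Adj⇒1≤deg H {u} {v} e = subst (1 ℕ.≤_) (sym (deg≡length H v)) (nonempty (∈-neighbours H e))
    where
    nonempty : ∀ {xs : List (Fin n)} → u ∈ xs → 1 ℕ.≤ length xs
    nonempty (here _)  = s≤s z≤n
    nonempty (there _) = s≤s z≤n

  Adj-sym : ∀ (H : Graph n) {u v : Fin n} → Adj H u v → Adj H v u
  Adj-sym H {u} {v} = subst (λ a → T a) (adj-sym H u v)

  Connected-sym : ∀ H {u v} → Connected H u v → Connected H v u
  Connected-sym H = Star.reverse (Adj-sym H)

  -- The opposite ends of the edges at `v`, kept with multiplicity so that the length counts the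
  -- occurrences of `v` as an endpoint.
  others : Fin n → List (Fin n × Fin n) → List (Fin n)
  others v []             = []
  others v ((x , y) ∷ es) = pick x y ++ pick y x ++ others v es
    where
    pick : Fin n → Fin n → List (Fin n)
    pick x y = if ⌊ v Fin.≟ x ⌋ then y ∷ [] else []

  length-others : ∀ v es → length (others v es) ≡ count v (endpoints es)
  length-others v [] = refl
  length-others v ((x , y) ∷ es) with v Fin.≟ x | v Fin.≟ y
  ... | yes _ | yes _ = cong (2 ℕ.+_) (length-others v es)
  ... | yes _ | no _  = cong suc (length-others v es)
  ... | no _  | yes _ = cong suc (length-others v es)
  ... | no _  | no _  = length-others v es

  ∈-others : ∀ {v u} es → (v , u) ∈ es ⊎ (u , v) ∈ es → u ∈ others v es
  ∈-others [] (inj₁ ())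
  ∈-others [] (inj₂ ())
  ∈-others {v} ((x , y) ∷ es) p with v Fin.≟ x | v Fin.≟ y | p
  ... | yes _  | _      | inj₁ (here refl) = here refl
  ... | no v≢x | _      | inj₁ (here refl) = contradiction refl v≢x
  ... | yes _  | yes _  | inj₂ (here refl) = there (here refl)
  ... | no _   | yes _  | inj₂ (here refl) = here refl
  ... | _      | no v≢y | inj₂ (here refl) = contradiction refl v≢y
  ... | yes _  | yes _  | inj₁ (there q)   = there (there (∈-others es (inj₁ q)))
  ... | yes _  | no _   | inj₁ (there q)   = there (∈-others es (inj₁ q))
  ... | no _   | yes _  | inj₁ (there q)   = there (∈-others es (inj₁ q))
  ... | no _   | no _   | inj₁ (there q)   = ∈-others es (inj₁ q)
  ... | yes _  | yes _  | inj₂ (there q)   = there (there (∈-others es (inj₂ q)))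
  ... | yes _  | no _   | inj₂ (there q)   = there (∈-others es (inj₂ q))
  ... | no _   | yes _  | inj₂ (there q)   = there (∈-others es (inj₂ q))
  ... | no _   | no _   | inj₂ (there q)   = ∈-others es (inj₂ q)

  -- Effect of an augmentation on edges, connectivity and degrees

  module _ {G : Graph n} {s t : Fin n} (H : Graph n) (P : Path G s t) where

    private
      es = extension H P

      _∈?_ : ∀ e es → Dec (e ∈ es)
      _∈?_ = mem? (Product.≡-dec (Fin._≟_ {n}) (λ {_} → Fin._≟_ {n}))

    augment-⊇ : H ⊆ augment H P
    augment-⊇ u v e = Equivalence.from T-∨ (inj₁ e)

    extension⊆augment : ∀ {u v} → (u , v) ∈ extension H P → Adj (augment H P) u v
    extension⊆augment {u} {v} e∈ = Equivalence.from (T-∨ {adj H u v}) 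
      (inj₂ (Equivalence.from (T-∨ {⌊ (u , v) ∈? es ⌋}) (inj₁ (fromWitness e∈))))

    augment-split : ∀ {u v} → Adj (augment H P) u v →
                    Adj H u v ⊎ ((u , v) ∈ extension H P ⊎ (v , u) ∈ extension H P)
    augment-split {u} {v} e with Equivalence.to (T-∨ {adj H u v}) e
    ... | inj₁ e′ = inj₁ e′
    ... | inj₂ e′ = inj₂ (Sum.map toWitness toWitness (Equivalence.to (T-∨ {⌊ (u , v) ∈? es ⌋} {⌊ (v , u) ∈? es ⌋}) e′))

    Connected-augment : ∀ {u v} → Connected H u v → Connected (augment H P) u v
    Connected-augment = Star.map (augment-⊇ _ _)

    deg-augment-≥ : ∀ v → deg H v ℕ.≤ deg (augment H P) v
    deg-augment-≥ v = subst (deg H v ℕ.≤_) (sym (deg≡length (augment H P) v))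
      (deg≤length H v (∈-neighbours (augment H P) ∘ augment-⊇ v _))

    deg-augment-≤ : ∀ v → deg (augment H P) v ℕ.≤ deg H v ℕ.+ count v (endpoints (extension H P))
    deg-augment-≤ v = subst (deg (augment H P) v ℕ.≤_)
      (trans (length-++ (neighbours H v)) (cong₂ ℕ._+_ (sym (deg≡length H v)) (length-others v (extension H P))))
      (deg≤length (augment H P) v λ e →
        Sum.[ (λ e′ → ∈-++⁺ˡ (∈-neighbours H e′)) , (λ e′ → ∈-++⁺ʳ (neighbours H v) (∈-others (extension H P) e′)) ]
          (augment-split e))

  -- Walks, simple paths and loop erasure

  module _ {R : Fin n → Fin n → Set} where

    count-sources : ∀ v {s t} (w : Star R s t) → count v (map proj₁ (edges w)) ℕ.≤ count v (vertices w)
    count-sources v ε       = z≤n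
    count-sources v {s} (e ◅ w) = ℕ.+-monoʳ-≤ (δ v s) (count-sources v w)

    -- The summand for the start makes the induction go through; it is dropped in
    -- `count-extension≤2`.
    count-targets : ∀ v {s t} (w : Star R s t) → δ v s ℕ.+ count v (map proj₂ (edges w)) ℕ.≤ count v (vertices w)
    count-targets v ε       = ℕ.≤-refl
    count-targets v {s} (e ◅ w) = ℕ.+-monoʳ-≤ (δ v s) (count-targets v w)

    ∈-edges : ∀ {s t} (w : Star R s t) {u v} → (u , v) ∈ edges w → R u v
    ∈-edges (e ◅ w) (here refl) = e
    ∈-edges (e ◅ w) (there p)   = ∈-edges w p

    walk-from : ∀ {s u t} (w : Star R u t) → Unique (vertices w) → s ∈ vertices w →
                ∃ λ (w′ : Star R s t) → Unique (vertices w′) × edges w′ ⊑ edges w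
    walk-from ε       u        (here refl) = ε , u , []
    walk-from (e ◅ w) u        (here refl) = e ◅ w , u , ⊆-refl
    walk-from (e ◅ w) (_ ∷ u)  (there s∈)  =
      let (w′ , u′ , sub) = walk-from w u s∈ in w′ , u′ , _ ∷ʳ sub

    loop-erase : ∀ {s t} (w : Star R s t) → ∃ λ (w′ : Star R s t) → Unique (vertices w′) × edges w′ ⊑ edges w
    loop-erase ε = ε , [] ∷ [] , []
    loop-erase {s} (e ◅ w) with loop-erase w
    ... | w′ , u , sub with mem? Fin._≟_ s (vertices w′)
    ...   | no s∉  = e ◅ w′ , ¬Any⇒All¬ _ s∉ ∷ u , refl ∷ sub
    ...   | yes s∈ = let (w″ , u″ , sub″) = walk-from w′ u s∈ in w″ , u″ , _ ∷ʳ ⊆-trans sub″ sub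

  external? : ∀ H (e : Fin n × Fin n) → Dec (¬ Connected H (proj₁ e) (proj₂ e))
  external? H e = ¬? (connected? H (proj₁ e) (proj₂ e))

  -- A simple path enters and leaves a vertex at most once each. This is the 2 in the uptick load,
  -- which therefore bounds the load after the step.
  count-extension≤2 : ∀ {G s t} H (P : Path G s t) v → count v (endpoints (extension H P)) ℕ.≤ 2
  count-extension≤2 H P v = begin
    count v (endpoints es)                                              ≡⟨ count-endpoints v es ⟩
    count v (map proj₁ es) ℕ.+ count v (map proj₂ es)                   ≤⟨ ℕ.+-mono-≤ (count-filter (external? H) proj₁ v (edges (walk P))) (count-filter (external? H) proj₂ v (edges (walk P))) ⟩
    count v (map proj₁ (edges (walk P))) ℕ.+ count v (map proj₂ (edges (walk P)))
      ≤⟨ ℕ.+-mono-≤ (count-sources v (walk P)) (ℕ.≤-trans (ℕ.m≤n+m _ _) (count-targets v (walk P))) ⟩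
    count v (vertices (walk P)) ℕ.+ count v (vertices (walk P))         ≤⟨ ℕ.+-mono-≤ (count-unique v (simple P)) (count-unique v (simple P)) ⟩
    2                                                                   ∎
    where
    open ℕ.≤-Reasoning
    es = extension H P

  module _ (G : Graph n) (H : Graph n) where

    -- The extension part of an arbitrary walk, since the walks built from shortcuts need not be
    -- simple.
    exts : ∀ {s t} → Star (Adj G) s t → List (Fin n × Fin n)
    exts w = filter (external? H) (edges w)

    exts-internal : ∀ {s u t} (e : Adj G s u) (w : Star (Adj G) u t) → Connected H s u → exts (e ◅ w) ≡ exts w
    exts-internal e w c = filter-reject (external? H) λ ¬c → ¬c c

    exts-external : ∀ {s u t} (e : Adj G s u) (w : Star (Adj G) u t) → ¬ Connected H s u → exts (e ◅ w) ≡ (s , u) ∷ exts w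
    exts-external e w ¬c = filter-accept (external? H) ¬c

    -- Loop erasure only deletes edges. This carries the greedy conditions, which speak of simple
    -- paths, over to all walks.
    simplify : ∀ {s t} (w : Star (Adj G) s t) → ∃ λ (Q : Path G s t) → extension H Q ⊑ exts w
    simplify w =
      let (w′ , u , sub) = loop-erase w
      in record { walk = w′ ; simple = u } , filter⁺ (external? H) (external? H) (λ { refl p → p }) sub

-- Extension edges and components

module _ {n : ℕ} where

  module _ (G : Graph n) (H : Graph n) (H⊆G : H ⊆ G) where

    exts-◅◅ : ∀ {s u t} (c : Connected H s u) (w : Star (Adj G) u t) →
              ∃ λ (w′ : Star (Adj G) s t) → exts G H w′ ≡ exts G H w
    exts-◅◅ ε       w = w , refl
    exts-◅◅ (e ◅ c) w =
      let (w′ , eq) = exts-◅◅ c w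
      in H⊆G _ _ e ◅ w′ , trans (exts-internal G H (H⊆G _ _ e) w′ (e ◅ ε)) eq

    -- Go from `s` to `z` inside their component of `H`, which costs no extension edge, and follow
    -- `w` from `z` on; the extension edges before `z` are saved.
    shortcut : ∀ {s u t z} (w : Star (Adj G) u t) → Connected H s z → z ∈ u ∷ map proj₂ (exts G H w) →
               ∃ λ (w′ : Star (Adj G) s t) → exts G H w′ ⊑ exts G H w
    shortcut w c (here refl) = let (w′ , eq) = exts-◅◅ c w in w′ , ⊆-reflexive eq
    shortcut ε c (there ())
    shortcut {u = u} {z = z} (_◅_ {j = v} e w) c (there z∈) = case connected? H u v of λ where
      (yes d) → let eq = exts-internal G H e w d
                    (w′ , sub) = shortcut w c (there (subst (λ es → z ∈ map proj₂ es) eq z∈))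
                in w′ , subst (exts G H w′ ⊑_) (sym eq) sub
      (no ¬d) → let eq = exts-external G H e w ¬d
                    (w′ , sub) = shortcut w c (subst (λ es → z ∈ map proj₂ es) eq z∈)
                in w′ , subst (exts G H w′ ⊑_) (sym eq) (_ ∷ʳ sub)

    pairwise-rehead : ∀ {s u ys} → Connected H s u → AllPairs (λ x y → ¬ Connected H x y) (u ∷ ys) →
                      AllPairs (λ x y → ¬ Connected H x y) (s ∷ ys)
    pairwise-rehead c (h ∷ t) = All.map (λ ¬d d → ¬d (Connected-sym H c ◅◅ d)) h ∷ t

    -- A walk visiting a component twice could be shortcut inside it.
    pairwise-disconnected : ∀ {s t} (w : Star (Adj G) s t) →
      (∀ (w′ : Star (Adj G) s t) → exts G H w′ ⊑ exts G H w → length (exts G H w) ℕ.≤ length (exts G H w′)) →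
      AllPairs (λ x y → ¬ Connected H x y) (s ∷ map proj₂ (exts G H w))
    pairwise-disconnected ε _ = [] ∷ []
    pairwise-disconnected {s} (_◅_ {j = u} e w) shortest = case connected? H s u of λ where
      (yes c) →
        let eq = exts-internal G H e w c
            rec = pairwise-disconnected w λ w′ sub →
              let eq′ = exts-internal G H e w′ c
              in subst₂ (λ es es′ → length es ℕ.≤ length es′) eq eq′
                   (shortest (e ◅ w′) (subst₂ _⊑_ (sym eq′) (sym eq) sub))
        in subst (λ es → AllPairs (λ x y → ¬ Connected H x y) (s ∷ map proj₂ es)) (sym eq) (pairwise-rehead c rec)
      (no ¬c) →
        let eq = exts-external G H e w ¬c
            rec = pairwise-disconnected w λ w′ sub →
              let eq′ = exts-external G H e w′ ¬c
              in ℕ.s≤s⁻¹ (subst₂ (λ es es′ → length es ℕ.≤ length es′) eq eq′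
                   (shortest (e ◅ w′) (subst₂ _⊑_ (sym eq′) (sym eq) (refl ∷ sub))))
            -- If `s` were connected to `u` or a later target `z`, the shortcut would save at least
            -- the extension edge `(s , u)`.
            fresh = All.tabulate λ {z} z∈ c →
              let (w′ , sub) = shortcut w c z∈
              in ℕ.1+n≰n (ℕ.≤-trans
                   (subst (λ es → length es ℕ.≤ length (exts G H w′)) eq
                     (shortest w′ (subst (exts G H w′ ⊑_) (sym eq) (_ ∷ʳ sub))))
                   (length-mono-≤ sub))
        in subst (λ es → AllPairs (λ x y → ¬ Connected H x y) (s ∷ map proj₂ es)) (sym eq) (fresh ∷ rec)

  -- Components met by a path and their representatives

  data Chain (R : Fin n → Fin n → Set) (c : Fin n) : List (Fin n × Fin n) → Set where
    []  : Chain R c []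
    _∷_ : ∀ {x y es} → R c x → Chain R y es → Chain R c ((x , y) ∷ es)

  chain-rehead : ∀ (H : Graph n) {s u es} → Connected H s u → Chain (Connected H) u es → Chain (Connected H) s es
  chain-rehead H c []      = []
  chain-rehead H c (d ∷ r) = (c ◅◅ d) ∷ r

  exts-chain : ∀ G H {s t} (w : Star (Adj G) s t) → Chain (Connected H) s (exts G H w)
  exts-chain G H ε = []
  exts-chain G H {s} (_◅_ {j = u} e w) = case connected? H s u of λ where
    (yes c) → subst (Chain (Connected H) s) (sym (exts-internal G H e w c)) (chain-rehead H c (exts-chain G H w))
    (no ¬c) → subst (Chain (Connected H) s) (sym (exts-external G H e w ¬c)) (ε ∷ exts-chain G H w)

  chain-connected : ∀ (H H′ : Graph n) {c es} → (∀ {u v} → Connected H u v → Connected H′ u v) →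
    (∀ {u v} → (u , v) ∈ es → Adj H′ u v) → Chain (Connected H) c es →
    ∀ {y} → y ∈ c ∷ map proj₂ es → Connected H′ c y
  chain-connected H H′ inc new ch      (here refl) = ε
  chain-connected H H′ inc new (d ∷ r) (there y∈)  =
    inc d ◅◅ (new (here refl) ◅ chain-connected H H′ inc (new ∘ there) r y∈)

  -- The length of `T` is the potential of the amortised count: an upper bound, lowered at each
  -- merge, for the number of components of `H` that meet `S`.
  Represents : List (Fin n) → Graph n → List (Fin n) → Set
  Represents S H T = ∀ {v} → v ∈ S → ∃ λ x → x ∈ T × Connected H v x

  module _ {S : List (Fin n)} (uS : Unique S) (H : Graph n) where

    private
      R : Fin n → Fin n → Set
      R = Connected H

      hits : Fin n → ℕ
      hits z = ∑ S λ v → δ v z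

      cost : List (Fin n) → ℕ
      cost zs = ∑ S λ v → count v zs

      cost-[] : cost [] ≡ 0
      cost-[] = trans (∑-const S 0) (ℕ.*-zeroʳ (length S))

      cost-∷ : ∀ z zs → cost (z ∷ zs) ≡ hits z ℕ.+ cost zs
      cost-∷ z zs = ∑-+ S (λ v → δ v z) (λ v → count v zs)

      -- `Z` holds one vertex of `S` for each component in which the path touches `S` at `c` or at
      -- an end of an extension edge. The term `hits c` treats `c` as the target of a preceding
      -- edge, which is what the induction along the chain adds up.
      record Met (c : Fin n) (es : List (Fin n × Fin n)) : Set where
        field
          Z        : List (Fin n)
          bound    : hits c ℕ.+ cost (endpoints es) ℕ.≤ 2 ℕ.* length Z
          within   : All (_∈ S) Z
          distinct : AllPairs (λ x y → ¬ R x y) Z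
          visited  : All (λ z → ∃ λ y → y ∈ c ∷ map proj₂ es × R z y) Z

      open Met

      -- The path enters and leaves each component at most once, so a component
      -- meeting S contributes at most 2 to the cost.
      meet : ∀ c es → Chain R c es → AllPairs (λ x y → ¬ R x y) (c ∷ map proj₂ es) → Met c es
      meet c [] _ _ with mem? Fin._≟_ c S
      ... | yes c∈ = record
        { Z = c ∷ [] ; within = c∈ ∷ [] ; distinct = [] ∷ [] ; visited = (c , here refl , ε) ∷ []
        ; bound = ℕ.≤-trans (ℕ.+-mono-≤ (∑-δ≤1 uS c) (ℕ.≤-reflexive cost-[])) (s≤s z≤n) }
      ... | no c∉ = record
        { Z = [] ; within = [] ; distinct = [] ; visited = []
        ; bound = ℕ.≤-reflexive (cong₂ ℕ._+_ (∑-δ-∉ S c∉) cost-[]) }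
      meet c ((x , y) ∷ es) (cx ∷ ch) (c# ∷ ps) with meet y es ch ps
      ... | m = case mem? Fin._≟_ c S of λ where
          (yes c∈) → add c c∈ ε
          (no c∉)  → case mem? Fin._≟_ x S of λ where
            (yes x∈) → add x x∈ (Connected-sym H cx)
            (no x∉)  → record
              { Z = Z m ; within = within m ; distinct = distinct m ; visited = All.map skip (visited m)
              ; bound = ℕ.≤-trans (ℕ.≤-reflexive (trans total (cong₂ (λ i j → i ℕ.+ (j ℕ.+ rest)) (∑-δ-∉ S c∉) (∑-δ-∉ S x∉)))) (bound m) }
        where
        rest : ℕ
        rest = hits y ℕ.+ cost (endpoints es)
        total : hits c ℕ.+ cost (x ∷ y ∷ endpoints es) ≡ hits c ℕ.+ (hits x ℕ.+ rest)
        total = cong (hits c ℕ.+_) (trans (cost-∷ x (y ∷ endpoints es)) (cong (hits x ℕ.+_) (cost-∷ y (endpoints es))))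
        skip : ∀ {z} → (∃ λ u → u ∈ y ∷ map proj₂ es × R z u) → ∃ λ u → u ∈ c ∷ y ∷ map proj₂ es × R z u
        skip (u , u∈ , r) = u , there u∈ , r
        add : ∀ a → a ∈ S → R a c → Met c ((x , y) ∷ es)
        add a a∈ r = record
          { Z = a ∷ Z m ; within = a∈ ∷ within m
          ; distinct = All.map (λ (u , u∈ , zu) az → All.lookup c# u∈ (Connected-sym H r ◅◅ az ◅◅ zu)) (visited m) ∷ distinct m
          ; visited = (c , here refl , r) ∷ All.map skip (visited m)
          ; bound = begin
              hits c ℕ.+ cost (x ∷ y ∷ endpoints es)     ≡⟨ total ⟩
              hits c ℕ.+ (hits x ℕ.+ rest)               ≤⟨ ℕ.+-mono-≤ (∑-δ≤1 uS c) (ℕ.+-mono-≤ (∑-δ≤1 uS x) (bound m)) ⟩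
              2 ℕ.+ 2 ℕ.* length (Z m)                   ≡⟨ ℕ.*-suc 2 (length (Z m)) ⟨
              2 ℕ.* suc (length (Z m))                   ∎ }
          where open ℕ.≤-Reasoning

      -- Members of `Z` lie in different components and so have different representatives, each of
      -- which can be removed. A vertex of `S` that loses its representative is still connected to a
      -- member of `Z`.
      thin : ∀ {T} Z → Represents S H T → All (_∈ S) Z → AllPairs (λ x y → ¬ R x y) Z →
        ∃ λ T′ → length T ≡ length Z ℕ.+ length T′ ×
          (∀ {v} → v ∈ S → (∃ λ x → x ∈ T′ × R v x) ⊎ (∃ λ z → z ∈ Z × R v z))
      thin {T} [] rep _ _ = T , refl , inj₁ ∘ rep
      thin (z ∷ Z) rep (z∈ ∷ Z⊆) (z# ∷ ps) with thin Z rep Z⊆ ps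
      ... | T′ , eq , split with split z∈
      ...   | inj₂ (z′ , z′∈ , r) = contradiction r (All.lookup z# z′∈)
      ...   | inj₁ (x , x∈ , zx) with remove x∈
      ...     | T″ , eq′ , keep = T″ , trans eq (trans (cong (length Z ℕ.+_) eq′) (ℕ.+-suc (length Z) (length T″))) ,
        λ v∈ → case split v∈ of λ where
          (inj₂ (z′ , z′∈ , r)) → inj₂ (z′ , there z′∈ , r)
          (inj₁ (y , y∈ , r))   → case keep y∈ of λ where
            (inj₁ refl) → inj₂ (z , here refl , r ◅◅ Connected-sym H zx)
            (inj₂ y∈′)  → inj₁ (y , y∈′ , r)

    -- The met components become one in `H′`, so a single representative can replace those of all
    -- members of `Z`. The `length Z - 1` representatives saved pay for the cost, which is at most
    -- `2 * length Z`, up to the constant 2.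
    represent-merge : ∀ {H′ c es T} → (∀ {u v} → Connected H u v → Connected H′ u v) →
      (∀ {u v} → (u , v) ∈ es → Adj H′ u v) →
      Chain (Connected H) c es → AllPairs (λ x y → ¬ Connected H x y) (c ∷ map proj₂ es) →
      Represents S H T →
      ∃ λ T′ → Represents S H′ T′ × ∑ S (λ v → count v (endpoints es)) ℕ.+ 2 ℕ.* length T′ ℕ.≤ 2 ℕ.+ 2 ℕ.* length T
    represent-merge {H′} {c} {es} {T} inc new ch ps rep = go (Z m) (bound m) (within m) (distinct m) (visited m)
      where
      m : Met c es
      m = meet c es ch ps
      joined : ∀ {x y} → (∃ λ u → u ∈ c ∷ map proj₂ es × R x u) → (∃ λ u → u ∈ c ∷ map proj₂ es × R y u) → Connected H′ x y
      joined (u , u∈ , xu) (v , v∈ , yv) =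
        inc xu ◅◅ Connected-sym H′ (chain-connected H H′ inc new ch u∈) ◅◅
        chain-connected H H′ inc new ch v∈ ◅◅ inc (Connected-sym H yv)
      go : ∀ Z → hits c ℕ.+ cost (endpoints es) ℕ.≤ 2 ℕ.* length Z → All (_∈ S) Z →
           AllPairs (λ x y → ¬ R x y) Z → All (λ z → ∃ λ y → y ∈ c ∷ map proj₂ es × R z y) Z →
           ∃ λ T′ → Represents S H′ T′ × cost (endpoints es) ℕ.+ 2 ℕ.* length T′ ℕ.≤ 2 ℕ.+ 2 ℕ.* length T
      go [] bd _ _ _ = T , (λ v∈ → let (x , x∈ , r) = rep v∈ in x , x∈ , inc r) ,
        ℕ.+-monoˡ-≤ (2 ℕ.* length T) (ℕ.≤-trans (ℕ.m≤n+m _ (hits c)) (ℕ.≤-trans bd (z≤n {2})))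
      -- Only the tail is thinned: the representative of `z` stays and serves the whole merged
      -- component.
      go (z ∷ Z) bd (z∈ ∷ Z⊆) (z# ∷ ps) (vz ∷ vZ) with thin Z rep Z⊆ ps
      ... | T′ , eq , split = T′ , rep′ , (begin
          cost (endpoints es) ℕ.+ 2 ℕ.* length T′           ≤⟨ ℕ.+-monoˡ-≤ (2 ℕ.* length T′) (ℕ.≤-trans (ℕ.m≤n+m _ (hits c)) bd) ⟩
          2 ℕ.* suc (length Z) ℕ.+ 2 ℕ.* length T′          ≡⟨ solve 2 (λ a b → con 2 :* (con 1 :+ a) :+ con 2 :* b := con 2 :+ con 2 :* (a :+ b)) refl (length Z) (length T′) ⟩
          2 ℕ.+ 2 ℕ.* (length Z ℕ.+ length T′)              ≡⟨ cong (λ l → 2 ℕ.+ 2 ℕ.* l) eq ⟨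
          2 ℕ.+ 2 ℕ.* length T                              ∎)
        where
        open ℕ.≤-Reasoning
        open ℕ-Solver
        rep′ : Represents S H′ T′
        rep′ v∈ = case split v∈ of λ where
          (inj₁ (x , x∈ , r))  → x , x∈ , inc r
          (inj₂ (y , y∈ , vy)) → case split z∈ of λ where
            (inj₁ (x , x∈ , zx))  → x , x∈ , inc vy ◅◅ joined (All.lookup vZ y∈) vz ◅◅ inc zx
            (inj₂ (z′ , z′∈ , r)) → contradiction r (All.lookup z# z′∈)

-- The greedy algorithm

module _ {A : Set} (f : A → ℝ) where

  ⨆-upper : ∀ {x} xs → x ∈ xs → f x ≼ foldr _⊔ᴿ_ 0ᴿ (map f xs)
  ⨆-upper (x ∷ xs) (here refl) = x≼x⊔y _ _
  ⨆-upper (x ∷ xs) (there x∈)  = ≼-trans (⨆-upper xs x∈) (y≼x⊔y _ _)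

  ⨆-lub : ∀ xs {z} → 0ᴿ ≼ z → (∀ {x} → x ∈ xs → f x ≼ z) → foldr _⊔ᴿ_ 0ᴿ (map f xs) ≼ z
  ⨆-lub []       0≼z _   = 0≼z
  ⨆-lub (x ∷ xs) 0≼z f≼z = ⊔ᴿ-lub (f≼z (here refl)) (⨆-lub xs 0≼z (f≼z ∘ there))

  0≼⨆ : ∀ xs → 0ᴿ ≼ foldr _⊔ᴿ_ 0ᴿ (map f xs)
  0≼⨆ []       = ≼-refl
  0≼⨆ (x ∷ xs) = ≼-trans (0≼⨆ xs) (y≼x⊔y _ _)

module _ {A : Set} where

  endpoints-⊑ : ∀ {es es′ : List (A × A)} {v} → es ⊑ es′ → v ∈ endpoints es → v ∈ endpoints es′
  endpoints-⊑ (_ ∷ʳ sub)   v∈                  = there (there (endpoints-⊑ sub v∈))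
  endpoints-⊑ (refl ∷ sub) (here v≡)           = here v≡
  endpoints-⊑ (refl ∷ sub) (there (here v≡))   = there (here v≡)
  endpoints-⊑ (refl ∷ sub) (there (there v∈))  = there (there (endpoints-⊑ sub v∈))

  endpoints-lookup : ∀ {P : A → Set} {es v} → All (λ e → P (proj₁ e) × P (proj₂ e)) es → v ∈ endpoints es → P v
  endpoints-lookup ((p , _) ∷ _)  (here refl)         = p
  endpoints-lookup ((_ , q) ∷ _)  (there (here refl)) = q
  endpoints-lookup (_ ∷ ps)       (there (there v∈))  = endpoints-lookup ps v∈

  endpoints-All⁻ : ∀ {P : A → Set} ds → All P (endpoints ds) → All (λ d → P (proj₁ d) × P (proj₂ d)) ds
  endpoints-All⁻ []       []           = []
  endpoints-All⁻ (_ ∷ ds) (p ∷ q ∷ ps) = (p , q) ∷ endpoints-All⁻ ds ps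

  length-endpoints : ∀ (ds : List (A × A)) → length (endpoints ds) ≡ length ds ℕ.* 2
  length-endpoints ds = trans (length-concatMap _ ds) (∑-const ds 2)

-- Double-negation shift over a finite index set; it allows deciding for all vertices at once which
-- of them are heavy.
¬¬-Π : ∀ {m} {P : Fin m → Set} → (∀ i → ¬ ¬ P i) → ¬ ¬ (∀ i → P i)
¬¬-Π {zero}  _  k = k λ ()
¬¬-Π {suc m} ps k = ps zero λ p → ¬¬-Π (ps ∘ suc) λ f → k (Fin.∀-cons p f)

module _ {n : ℕ} (G : Graph n) (b : Fin n → Bound) where

  uptick≼ : ∀ H v → uptick b H v ≼ (deg H v ℕ.+ 2) ÷ b v
  uptick≼ H v = proj₂ (÷-+ (deg H v) 2 (b v))

  ≼uptick : ∀ H v → (deg H v ℕ.+ 2) ÷ b v ≼ uptick b H v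
  ≼uptick H v = proj₁ (÷-+ (deg H v) 2 (b v))

  uptick-mono : ∀ H H′ v → deg H v ℕ.≤ deg H′ v → uptick b H v ≼ uptick b H′ v
  uptick-mono H H′ v d≤ = +ᴿ-mono-≼ (÷-mono-≼ (b v) d≤) ≼-refl

  upticks-mono : ∀ H {es es′} → es ⊑ es′ → upticks b H es ≼ upticks b H es′
  upticks-mono H {es} {es′} sub = ⨆-lub (uptick b H) (endpoints es) (0≼⨆ (uptick b H) (endpoints es′)) λ v∈ →
    ⨆-upper (uptick b H) (endpoints es′) (endpoints-⊑ sub v∈)

  module _ {s t : Fin n} {H : Graph n} {P : Path G s t} (g : Greedy G b H P) where

    greedy-minimal : ∀ (w : Star (Adj G) s t) → upticks b H (extension H P) ≼ upticks b H (exts G H w)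
    greedy-minimal w =
      let (Q , sub) = simplify G H w
      in ≼-trans (≤ᴿ⇒≼ (Greedy.minimal g Q)) (upticks-mono H sub)

    -- The tie-break applies only at equal uptick load. A sublist of the extension part has no
    -- larger uptick load, and by minimality no smaller one.
    greedy-shortest : ∀ (w : Star (Adj G) s t) → exts G H w ⊑ extension H P →
                      length (extension H P) ℕ.≤ length (exts G H w)
    greedy-shortest w w⊑P =
      let (Q , sub) = simplify G H w
      in ℕ.≤-trans (Greedy.fewest g Q (≼⇒≤ᴿ (upticks-mono H (⊆-trans sub w⊑P)) , Greedy.minimal g Q)) (length-mono-≤ sub)

  augment-⊆ : ∀ {s t} {H : Graph n} → H ⊆ G → (P : Path G s t) → augment H P ⊆ G
  augment-⊆ {H = H} H⊆G P u v e with augment-split H P e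
  ... | inj₁ e′        = H⊆G u v e′
  ... | inj₂ (inj₁ e∈) = ∈-edges (walk P) (proj₁ (∈-filter⁻ (external? H) e∈))
  ... | inj₂ (inj₂ e∈) = Adj-sym G (∈-edges (walk P) (proj₁ (∈-filter⁻ (external? H) e∈)))

  -- Runs, marked demands and the degrees they add

  run-deg : ∀ {H ds H′} → Run G b H ds H′ → ∀ v → deg H v ℕ.≤ deg H′ v
  run-deg done              v = ℕ.≤-refl
  run-deg {H} (serve P _ ρ) v = ℕ.≤-trans (deg-augment-≥ H P v) (run-deg ρ v)

  -- Marked r ρ k: exactly k of the demands served in ρ have ℓ⁺(P*) > r.
  data Marked (r : ℝ) : ∀ {H ds H′} → Run G b H ds H′ → ℕ → Set where
    done : ∀ {H} → Marked r (done {H = H}) 0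
    low  : ∀ {H H′ s t ds k} {P : Path G s t} {g : Greedy G b H P} {ρ : Run G b (augment H P) ds H′} →
           upticks b H (extension H P) ≼ r → Marked r ρ k → Marked r (serve P g ρ) k
    high : ∀ {H H′ s t ds k} {P : Path G s t} {g : Greedy G b H P} {ρ : Run G b (augment H P) ds H′} →
           ¬ upticks b H (extension H P) ≼ r → Marked r ρ k → Marked r (serve P g ρ) (suc k)

  ¬¬marked : ∀ r {H ds H′} (ρ : Run G b H ds H′) → ¬ ¬ ∃ (Marked r ρ)
  ¬¬marked r done          k = k (0 , done)
  ¬¬marked r (serve P g ρ) k = ¬¬marked r ρ λ (_ , μ) → ¬¬-excluded-middle λ where
    (yes p) → k (_ , low p μ)
    (no ¬p) → k (_ , high ¬p μ)

  marked≤length : ∀ {r H ds H′ k} {ρ : Run G b H ds H′} → Marked r ρ k → k ℕ.≤ length ds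
  marked≤length done       = z≤n
  marked≤length (low _ μ)  = ℕ.m≤n⇒m≤1+n (marked≤length μ)
  marked≤length (high _ μ) = s≤s (marked≤length μ)

  -- The degree that `v` receives in marked steps, counted as occurrences among the endpoints of
  -- their extension parts.
  excess : ∀ {r H ds H′ k} {ρ : Run G b H ds H′} → Marked r ρ k → Fin n → ℕ
  excess done                         v = 0
  excess (low _ μ)                    v = excess μ v
  excess (high {H = H} {P = P} _ μ)   v = count v (endpoints (extension H P)) ℕ.+ excess μ v

  excess-zero : ∀ {r H ds H′} {ρ : Run G b H ds H′} (μ : Marked r ρ 0) v → excess μ v ≡ 0
  excess-zero done      v = refl
  excess-zero (low _ μ) v = excess-zero μ v

  -- Unmarked steps raise the degree of v only while its uptick load is at most r.
  deg≤excess : ∀ {r H ds H′ k} {ρ : Run G b H ds H′} (μ : Marked r ρ k) v {e m} →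
    deg H v ℕ.≤ e ℕ.+ m → m ÷ b v ≼ r →
    ∃ λ m′ → deg H′ v ℕ.≤ e ℕ.+ excess μ v ℕ.+ m′ × m′ ÷ b v ≼ r
  deg≤excess {H = H} done v {e} {m} d≤ m≼ = m , subst (λ a → deg H v ℕ.≤ a ℕ.+ m) (sym (ℕ.+-identityʳ e)) d≤ , m≼
  deg≤excess {r} (low {H = H} {P = P} p μ) v {e} {m} d≤ m≼ with count≡0⊎∈ v (endpoints (extension H P))
  ... | inj₁ eq = deg≤excess μ v (ℕ.≤-trans (deg-augment-≤ H P v)
    (ℕ.≤-trans (ℕ.≤-reflexive (trans (cong (deg H v ℕ.+_) eq) (ℕ.+-identityʳ (deg H v)))) d≤)) m≼
  -- An unmarked step touching `v` resets the second summand: the whole degree after the step is at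
  -- most `deg H v + 2`, whose load is the uptick load and hence at most `r`.
  ... | inj₂ v∈ = deg≤excess μ v {e} {deg H v ℕ.+ 2}
    (ℕ.≤-trans (deg-augment-≤ H P v) (ℕ.≤-trans (ℕ.+-monoʳ-≤ (deg H v) (count-extension≤2 H P v)) (ℕ.m≤n+m _ e)))
    (≼-trans (≼uptick H v) (≼-trans (⨆-upper (uptick b H) (endpoints (extension H P)) v∈) p))
  deg≤excess {H′ = H′} (high {H = H} {P = P} _ μ) v {e} {m} d≤ m≼ =
    let c = count v (endpoints (extension H P))
        (m′ , d′≤ , m′≼) = deg≤excess μ v {e ℕ.+ c} {m}
          (ℕ.≤-trans (deg-augment-≤ H P v) (ℕ.≤-trans (ℕ.+-monoˡ-≤ c d≤)
            (ℕ.≤-reflexive (solve 3 (λ e m c → e :+ m :+ c := e :+ c :+ m) refl e m c)))) m≼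
    in m′ , subst (λ a → deg H′ v ℕ.≤ a ℕ.+ m′) (ℕ.+-assoc e c (excess μ v)) d′≤ , m′≼
    where open ℕ-Solver

  -- Amortised with potential `2 * length T`: a marked step costs at most 2 plus the drop in
  -- potential, and an unmarked step only coarsens components, so the same `T` still represents `S`.
  ∑-excess : ∀ {r S T H ds H′ k} {ρ : Run G b H ds H′} (uS : Unique S) → H ⊆ G → (μ : Marked r ρ k) →
             Represents S H T → ∑ S (excess μ) ℕ.≤ 2 ℕ.* k ℕ.+ 2 ℕ.* length T
  ∑-excess {S = S} uS H⊆G done rep =
    ℕ.≤-trans (ℕ.≤-reflexive (trans (∑-const S 0) (ℕ.*-zeroʳ (length S)))) z≤n
  ∑-excess uS H⊆G (low {H = H} {P = P} _ μ) rep = ∑-excess uS (augment-⊆ H⊆G P) μ λ v∈ →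
    let (x , x∈ , c) = rep v∈ in x , x∈ , Connected-augment H P c
  ∑-excess {S = S} {T} uS H⊆G (high {H = H} {k = k} {P = P} {g = g} ¬≼r μ) rep =
    let (T′ , rep′ , cost≤) = represent-merge uS H {augment H P} (Connected-augment H P) (extension⊆augment H P)
          (exts-chain G H (walk P)) (pairwise-disconnected G H H⊆G (walk P) (greedy-shortest g)) rep
        A = ∑ S (λ v → count v (endpoints (extension H P)))
        B = ∑ S (excess μ)
    in begin
      ∑ S (excess (high {g = g} ¬≼r μ))           ≡⟨ ∑-+ S (λ v → count v (endpoints (extension H P))) (excess μ) ⟩
      A ℕ.+ B                                   ≤⟨ ℕ.+-monoʳ-≤ A (∑-excess uS (augment-⊆ H⊆G P) μ rep′) ⟩
      A ℕ.+ (2 ℕ.* k ℕ.+ 2 ℕ.* length T′)       ≡⟨ solve 3 (λ a k t → a :+ (k :+ t) := k :+ (a :+ t)) refl A (2 ℕ.* k) (2 ℕ.* length T′) ⟩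
      2 ℕ.* k ℕ.+ (A ℕ.+ 2 ℕ.* length T′)       ≤⟨ ℕ.+-monoʳ-≤ (2 ℕ.* k) cost≤ ⟩
      2 ℕ.* k ℕ.+ (2 ℕ.+ 2 ℕ.* length T)        ≡⟨ solve 2 (λ k t → con 2 :* k :+ (con 2 :+ t) := con 2 :* (con 1 :+ k) :+ t) refl k (2 ℕ.* length T) ⟩
      2 ℕ.* suc k ℕ.+ 2 ℕ.* length T            ∎
    where
    open ℕ.≤-Reasoning
    open ℕ-Solver

  -- Marked demands against heavy vertices of the optimum

  module _ {r : ℝ} (0≼r : 0ᴿ ≼ r) (H∞ : Graph n) (low? : ∀ v → Dec (uptick b H∞ v ≼ r))
           (H* : Graph n) (H*⊆G : H* ⊆ G) where

    private
      Low : Fin n → Set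
      Low v = uptick b H∞ v ≼ r

    -- Vertices isolated in `H*` are left out, so that the number of heavy vertices is at most the
    -- sum of their degrees in `H*`.
    heavy : List (Fin n)
    heavy = filter (λ v → ¬? (low? v) ×-dec (1 ℕ.≤? deg H* v)) (allFin n)

    ∈-heavy⁻ : ∀ {v} → v ∈ heavy → ¬ Low v × 1 ℕ.≤ deg H* v
    ∈-heavy⁻ v∈ = proj₂ (∈-filter⁻ (λ v → ¬? (low? v) ×-dec (1 ℕ.≤? deg H* v)) {xs = allFin n} v∈)

    -- Listed with multiplicity, so that the length is the degree sum. An `H*`-path from a low
    -- vertex has a tip just before its first vertex that is not low.
    tips : List (Fin n)
    tips = concatMap (neighbours H*) heavy

    ∈-tips : ∀ {u v} → ¬ Low v → Adj H* v u → u ∈ tips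
    ∈-tips {v = v} ¬low e = ∈-concat⁺′ (∈-neighbours H* e) (∈-map⁺ (neighbours H*)
      (∈-filter⁺ (λ v → ¬? (low? v) ×-dec (1 ℕ.≤? deg H* v)) (∈-allFin v) (¬low , Adj⇒1≤deg H* e)))

    private
      -- Edges that cannot raise the uptick load of a walk above `r`: either they are not extension
      -- edges, or both ends respect `r` even in the final graph.
      Cheap : Graph n → Fin n → Fin n → Set
      Cheap H x y = Connected H x y ⊎ (Low x × Low y)

      Step : Graph n → Fin n → Fin n → Set
      Step H x y = Adj G x y × Cheap H x y

      Step-sym : ∀ H {x y} → Star (Step H) x y → Star (Step H) y x
      Step-sym H = Star.reverse λ (e , c) → Adj-sym G e , Sum.map (Connected-sym H) (λ (p , q) → q , p) c

      cheap-walk : ∀ H {x y} → Star (Step H) x y →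
        ∃ λ (w : Star (Adj G) x y) → All (λ e → Cheap H (proj₁ e) (proj₂ e)) (edges w)
      cheap-walk H ε = ε , []
      cheap-walk H ((e , c) ◅ p) = let (w , cs) = cheap-walk H p in e ◅ w , c ∷ cs

      -- A walk of cheap edges has an extension part with low ends only. Uptick loads grow during
      -- the run, so its present value is at most `r`, and by minimality so is that of `P`.
      separated : ∀ {s t H} {P : Path G s t} → Greedy G b H P → (∀ v → deg H v ℕ.≤ deg H∞ v) →
        ¬ upticks b H (extension H P) ≼ r → ¬ Star (Step H) s t
      separated {H = H} g d≤ ¬≼r p =
        let (w , cs) = cheap-walk H p
            lows = All.tabulate λ {e} e∈ →
              let (e∈w , ¬c) = ∈-filter⁻ (external? H) {xs = edges w} e∈
              in Sum.[ (λ c → contradiction c ¬c) , (λ l → l) ] (All.lookup cs e∈w)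
        in ¬≼r (≼-trans (greedy-minimal g w) (⨆-lub (uptick b H) (endpoints (exts G H w)) 0≼r λ {v} v∈ →
             ≼-trans (uptick-mono H H∞ v (d≤ v)) (endpoints-lookup {P = Low} lows v∈)))

      -- Follow the `H*`-path until its next vertex is not low: up to there all edges join low
      -- vertices and are cheap.
      exit : ∀ H {u t} → Low u → Connected H* u t → (∃ λ z → z ∈ tips × Star (Step H) u z) ⊎ Star (Step H) u t
      exit H lu ε = inj₂ ε
      exit H {u} lu (_◅_ {j = v} e w) with low? v
      ... | no ¬lv = inj₁ (u , ∈-tips ¬lv (Adj-sym H* e) , ε)
      ... | yes lv = let step = H*⊆G _ _ e , inj₂ (lu , lv)
        in Sum.map (λ (z , z∈ , p) → z , z∈ , step ◅ p) (step ◅_) (exit H lv w)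

      -- Since `Step` asks for edges of `G`, the path `P` itself is used: each of its edges is
      -- either added or already lies inside a component of `H`.
      served : ∀ {s t} H (P : Path G s t) → Star (Step (augment H P)) s t
      served H P = go (walk P) λ e∈ → case external? H _ of λ where
          (yes ¬c) → extension⊆augment H P (∈-filter⁺ (external? H) e∈ ¬c) ◅ ε
          (no ¬¬c) → Connected-augment H P (decidable-stable (connected? H _ _) ¬¬c)
        where
        go : ∀ {x y} (w : Star (Adj G) x y) → (∀ {u v} → (u , v) ∈ edges w → Connected (augment H P) u v) →
             Star (Step (augment H P)) x y
        go ε       _ = ε
        go (e ◅ w) c = (e , inj₁ (c (here refl))) ◅ go w (c ∘ there)

    -- `T` represents the classes of tips under `Step H`. The ends of a marked demand reach tips of
    -- two different classes, by `separated`; serving the demand joins these classes, so each marked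
    -- demand uses up one representative.
    marked≤representatives : ∀ {H ds k T} {ρ : Run G b H ds H∞} → Marked r ρ k →
      All (λ d → (Low (proj₁ d) × Low (proj₂ d)) × Connected H* (proj₁ d) (proj₂ d)) ds →
      (∀ {z} → z ∈ tips → ∃ λ x → x ∈ T × Star (Step H) z x) → k ℕ.≤ length T
    marked≤representatives done _ _ = z≤n
    marked≤representatives (low {H = H} {P = P} _ μ) (_ ∷ ds) rep = marked≤representatives μ ds λ z∈ →
      let (x , x∈ , p) = rep z∈
      in x , x∈ , Star.map (λ (e , c) → e , Sum.map₁ (Connected-augment H P) c) p
    marked≤representatives {T = T} {ρ = ρ} (high {H = H} {s = s} {t} {P = P} {g} ¬≼r μ) (((ls , lt) , c) ∷ ds) rep
      with exit H ls c | exit H lt (Connected-sym H* c)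
    ... | inj₂ p | _ = contradiction p (separated g (run-deg ρ) ¬≼r)
    ... | inj₁ _ | inj₂ p = contradiction (Step-sym H p) (separated g (run-deg ρ) ¬≼r)
    ... | inj₁ (z₁ , z₁∈ , sz₁) | inj₁ (z₂ , z₂∈ , tz₂) with rep z₁∈ | rep z₂∈
    ...   | x , x∈ , zx | y , y∈ , zy with remove x∈
    ...     | T′ , eq , keep = subst (_ ℕ.≤_) (sym eq) (s≤s (marked≤representatives μ ds rep′))
      where
      up : ∀ {u v} → Star (Step H) u v → Star (Step (augment H P)) u v
      up = Star.map λ (e , c) → e , Sum.map₁ (Connected-augment H P) c
      y≢x : y ≢ x
      y≢x refl = separated g (run-deg ρ) ¬≼r (sz₁ ◅◅ zx ◅◅ Step-sym H (tz₂ ◅◅ zy))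
      y∈′ : y ∈ T′
      y∈′ = Sum.[ (λ y≡x → contradiction y≡x y≢x) , (λ p → p) ] (keep y∈)
      rep′ : ∀ {z} → z ∈ tips → ∃ λ x → x ∈ T′ × Star (Step (augment H P)) z x
      rep′ z∈ with rep z∈
      ... | x′ , x′∈ , p with keep x′∈
      ...   | inj₂ x′∈′ = x′ , x′∈′ , up p
      -- Tips that were represented by the removed `x` pass to `y`, through `s`, the path just
      -- served, and `t`.
      ...   | inj₁ refl = y , y∈′ , up p ◅◅ up (Step-sym H (sz₁ ◅◅ zx)) ◅◅ served H P ◅◅ up (tz₂ ◅◅ zy)

    marked≤∑-heavy : ∀ {H ds k} {ρ : Run G b H ds H∞} → Marked r ρ k →
      All (λ d → (Low (proj₁ d) × Low (proj₂ d)) × Connected H* (proj₁ d) (proj₂ d)) ds →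
      k ℕ.≤ ∑ heavy (deg H*)
    marked≤∑-heavy {k = k} μ ds = begin
      k                                        ≤⟨ marked≤representatives μ ds (λ z∈ → _ , z∈ , ε) ⟩
      length tips                              ≡⟨ length-concatMap (neighbours H*) heavy ⟩
      ∑ heavy (λ v → length (neighbours H* v)) ≤⟨ ∑-mono heavy (λ {v} _ → ℕ.≤-reflexive (sym (deg≡length H* v))) ⟩
      ∑ heavy (deg H*)                         ∎
      where open ℕ.≤-Reasoning

    heavy-unique : Unique heavy
    heavy-unique = Unique.filter⁺ (λ v → ¬? (low? v) ×-dec (1 ℕ.≤? deg H* v)) (Unique.allFin⁺ n)

  -- Halving the number of marked demands, and the load bound

  deg-∅ : ∀ v → deg {n} ∅ v ℕ.≤ 0
  deg-∅ v = deg≤length ∅ v {[]} λ ()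

  module _ {x : ℝ} {ds : List (Fin n × Fin n)} {H* H : Graph n}
           (opt≼x : ∀ v → deg H* v ÷ b v ≼ x) (0≼x : 0ᴿ ≼ x)
           (H*⊆G : H* ⊆ G) (conn : All (λ d → Connected H* (proj₁ d) (proj₂ d)) ds)
           (inf : All (λ v → b v ≡ ∞) (endpoints ds)) (ρ : GA G b ds H) where

    private
      uptick-∞ : ∀ {v} i → b v ≡ ∞ → uptick b H v ≼ i ×ᴿ x
      uptick-∞ {v} i eq = ≼-trans (uptick≼ H v)
        (subst (λ β → (deg H v ℕ.+ 2) ÷ β ≼ i ×ᴿ x) (sym eq) (×ᴿ-nonNeg i 0≼x))

    -- Apart from the excess, the degree of `v` is at most some `m` with load at most `i ×ᴿ x`. Were
    -- the claim false, the degree plus 2 would be at most `8 * deg H* v + m`, and the uptick load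
    -- would respect the raised threshold.
    excess-heavy : ∀ {i k v} (μ : Marked (i ×ᴿ x) ρ k) → ¬ uptick b H v ≼ (8 ℕ.+ i) ×ᴿ x →
                   8 ℕ.* deg H* v ℕ.≤ excess μ v ℕ.+ 2
    excess-heavy {i} {k} {v} μ ¬low with deg≤excess μ v {0} {0} (deg-∅ v) (≼-trans (0÷≼0 (b v)) (×ᴿ-nonNeg i 0≼x))
    ... | m , d≤ , m≼ = ℕ.≮⇒≥ λ lt → ¬low (≼-trans (uptick≼ H v) (≼-trans (÷-mono-≼ (b v) (d+2≤ lt)) (÷-×ᴿ (b v) 8 (opt≼x v) m≼)))
      where
      open ℕ.≤-Reasoning
      open ℕ-Solver
      d+2≤ : excess μ v ℕ.+ 2 ℕ.< 8 ℕ.* deg H* v → deg H v ℕ.+ 2 ℕ.≤ 8 ℕ.* deg H* v ℕ.+ m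
      d+2≤ lt = begin
        deg H v ℕ.+ 2                ≤⟨ ℕ.+-monoˡ-≤ 2 d≤ ⟩
        excess μ v ℕ.+ m ℕ.+ 2       ≡⟨ solve 2 (λ e m → e :+ m :+ con 2 := e :+ con 2 :+ m) refl (excess μ v) m ⟩
        excess μ v ℕ.+ 2 ℕ.+ m       ≤⟨ ℕ.+-monoˡ-≤ m (ℕ.<⇒≤ lt) ⟩
        8 ℕ.* deg H* v ℕ.+ m         ∎

    -- Counting gives `k′ ≤ X` on one side and `8 * X ≤ 2 * k + 4 * length S ≤ 2 * k + 4 *
    -- X` on the other, so `4 * k′ ≤ 4 * X ≤ 2 * k`. The 8 covers the 4 lost to `S` and leaves the 4
    -- that yields the factor two.
    marked-halves : ∀ {i k k′} → Marked (i ×ᴿ x) ρ k → Marked ((8 ℕ.+ i) ×ᴿ x) ρ k′ →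
      (∀ v → Dec (uptick b H v ≼ (8 ℕ.+ i) ×ᴿ x)) → 2 ℕ.* k′ ℕ.≤ k
    marked-halves {i} {k} {k′} μ μ′ low? = ℕ.*-cancelˡ-≤ 2 (ℕ.+-cancelʳ-≤ (4 ℕ.* X) (2 ℕ.* (2 ℕ.* k′)) (2 ℕ.* k) (begin
      2 ℕ.* (2 ℕ.* k′) ℕ.+ 4 ℕ.* X               ≤⟨ ℕ.+-monoˡ-≤ (4 ℕ.* X) (ℕ.*-monoʳ-≤ 2 (ℕ.*-monoʳ-≤ 2 k′≤X)) ⟩
      2 ℕ.* (2 ℕ.* X) ℕ.+ 4 ℕ.* X                ≡⟨ solve 1 (λ X → con 2 :* (con 2 :* X) :+ con 4 :* X := con 8 :* X) refl X ⟩
      8 ℕ.* X                                    ≡⟨ ∑-* 8 S (deg H*) ⟨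
      ∑ S (λ v → 8 ℕ.* deg H* v)                 ≤⟨ ∑-mono S (λ v∈ → excess-heavy {i} μ (proj₁ (∈-heavy⁻ 0≼r H low? H* H*⊆G v∈))) ⟩
      ∑ S (λ v → excess μ v ℕ.+ 2)               ≡⟨ trans (∑-+ S (excess μ) (λ _ → 2)) (cong (∑ S (excess μ) ℕ.+_) (∑-const S 2)) ⟩
      ∑ S (excess μ) ℕ.+ length S ℕ.* 2          ≤⟨ ℕ.+-monoˡ-≤ (length S ℕ.* 2) (∑-excess uS (λ _ _ ()) μ (λ v∈ → _ , v∈ , ε)) ⟩
      2 ℕ.* k ℕ.+ 2 ℕ.* length S ℕ.+ length S ℕ.* 2
        ≡⟨ solve 2 (λ k s → con 2 :* k :+ con 2 :* s :+ s :* con 2 := con 2 :* k :+ con 4 :* s) refl k (length S) ⟩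
      2 ℕ.* k ℕ.+ 4 ℕ.* length S                 ≤⟨ ℕ.+-monoʳ-≤ (2 ℕ.* k) (ℕ.*-monoʳ-≤ 4 S≤X) ⟩
      2 ℕ.* k ℕ.+ 4 ℕ.* X                        ∎))
      where
      open ℕ.≤-Reasoning
      open ℕ-Solver
      0≼r : 0ᴿ ≼ (8 ℕ.+ i) ×ᴿ x
      0≼r = ×ᴿ-nonNeg (8 ℕ.+ i) 0≼x
      S : List (Fin n)
      S = heavy 0≼r H low? H* H*⊆G
      uS : Unique S
      uS = heavy-unique 0≼r H low? H* H*⊆G
      X : ℕ
      X = ∑ S (deg H*)
      k′≤X : k′ ℕ.≤ X
      k′≤X = marked≤∑-heavy 0≼r H low? H* H*⊆G μ′
        (All.zip (All.map (λ (p , q) → uptick-∞ (8 ℕ.+ i) p , uptick-∞ (8 ℕ.+ i) q) (endpoints-All⁻ ds inf) , conn))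
      S≤X : length S ℕ.≤ X
      S≤X = ℕ.≤-trans (ℕ.≤-reflexive (sym (trans (∑-const S 1) (ℕ.*-identityʳ (length S)))))
        (∑-mono S (λ v∈ → proj₂ (∈-heavy⁻ 0≼r H low? H* H*⊆G v∈)))

    marked-decay : ∀ j {k} → Marked ((j ℕ.* 8) ×ᴿ x) ρ k → 2 ℕ.^ j ℕ.* k ℕ.≤ length ds
    marked-decay zero {k} μ = ℕ.≤-trans (ℕ.≤-reflexive (ℕ.*-identityˡ k)) (marked≤length μ)
    -- The goal is a decidable inequality of naturals, so the previous marking and the decisions
    -- about heaviness may be assumed under double negation.
    marked-decay (suc j) {k} μ = decidable-stable (_ ℕ.≤? _) λ ≰ →
      ¬¬marked ((j ℕ.* 8) ×ᴿ x) ρ λ (k₀ , μ₀) →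
      ¬¬-Π (λ _ → ¬¬-excluded-middle) λ low? → ≰ (begin
        2 ℕ.^ suc j ℕ.* k        ≡⟨ solve 2 (λ a k → con 2 :* a :* k := a :* (con 2 :* k)) refl (2 ℕ.^ j) k ⟩
        2 ℕ.^ j ℕ.* (2 ℕ.* k)    ≤⟨ ℕ.*-monoʳ-≤ (2 ℕ.^ j) (marked-halves {j ℕ.* 8} μ₀ μ low?) ⟩
        2 ℕ.^ j ℕ.* k₀           ≤⟨ marked-decay j μ₀ ⟩
        length ds                ∎)
      where
      open ℕ.≤-Reasoning
      open ℕ-Solver

    unmarked⇒maxLoad≼ : ∀ {i} → Marked (i ×ᴿ x) ρ 0 → maxLoad b H ≼ i ×ᴿ x
    unmarked⇒maxLoad≼ {i} μ = ⨆-lub (load b H) (allFin n) (×ᴿ-nonNeg i 0≼x) λ {v} _ →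
      let (m , d≤ , m≼) = deg≤excess μ v {0} {0} (deg-∅ v) (≼-trans (0÷≼0 (b v)) (×ᴿ-nonNeg i 0≼x))
      in ≼-trans (÷-mono-≼ (b v) (subst (λ a → deg H v ℕ.≤ a ℕ.+ m) (excess-zero μ v) d≤)) m≼

    -- Distinct endpoints leave room for at most `n / 2` demands. A demand still marked after `L`
    -- halvings would force `2 ^ L ≤ length ds`, hence `2 ^ suc L ≤ n`.
    maxLoad≼ : Unique (endpoints ds) → ∀ {L} → n ℕ.< 2 ℕ.^ suc L → maxLoad b H ≼ (L ℕ.* 8) ×ᴿ x
    maxLoad≼ u {L} n< = ≼-stable λ ⋠ → ¬¬marked ((L ℕ.* 8) ×ᴿ x) ρ λ where
        (zero , μ)  → ⋠ (unmarked⇒maxLoad≼ {L ℕ.* 8} μ)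
        (suc k , μ) → ℕ.n≮n n (ℕ.<-≤-trans n< (begin
          2 ℕ.* 2 ℕ.^ L             ≡⟨ ℕ.*-comm 2 (2 ℕ.^ L) ⟩
          2 ℕ.^ L ℕ.* 2             ≤⟨ ℕ.*-monoˡ-≤ 2 (ℕ.m≤m*n (2 ℕ.^ L) (suc k)) ⟩
          2 ℕ.^ L ℕ.* suc k ℕ.* 2   ≤⟨ ℕ.*-monoˡ-≤ 2 (marked-decay L μ) ⟩
          length ds ℕ.* 2           ≡⟨ length-endpoints ds ⟨
          length (endpoints ds)     ≤⟨ unique-⊆⇒length≤ u (λ {v} _ → ∈-allFin v) ⟩
          length (allFin n)         ≡⟨ length-tabulate (λ i → i) ⟩
          n                         ∎))
      where open ℕ.≤-Reasoning

theorem1 : ∃ λ (c : ℝ) → 0ᴿ <ᴿ c ×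
    (∀ (n : ℕ) → 2 ≤ n →
    (G : Graph n) (b : Fin n → Bound) (demands : List (Fin n × Fin n)) →
    Unique (endpoints demands) →
    All (λ v → deg G v ≡ 1 × b v ≡ ∞) (endpoints demands) →
    (H : Graph n) → GA G b demands H →
    (OPT : ℝ) → IsOPT G b demands OPT →
    maxLoad b H ≤ᴿ c *ᴿ log₂ n *ᴿ OPT)
-- The constant is the raise of the threshold, in multiples of the optimum, that one halving costs;
-- `1ℚ` witnesses that it is positive.
theorem1 = fromℕ 8 , (1ℚ , ℚ.positive⁻¹ 1ℚ , 0 , λ _ → toWitness {a? = (0ℚ ℚ.+ 1ℚ) ℚ.≤? _} _) , bound
  where
  bound : ∀ n → 2 ≤ n → (G : Graph n) (b : Fin n → Bound) (demands : List (Fin n × Fin n)) →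
    Unique (endpoints demands) → All (λ v → deg G v ≡ 1 × b v ≡ ∞) (endpoints demands) →
    (H : Graph n) → GA G b demands H → (OPT : ℝ) → IsOPT G b demands OPT →
    maxLoad b H ≤ᴿ fromℕ 8 *ᴿ log₂ n *ᴿ OPT
  bound (suc n) _ G b demands u ends H ρ OPT ((H* , (H*⊆G , conn) , max≤ , _) , _) =
    let (L , lo , hi) = dyadic n
        0≼OPT : 0ᴿ ≼ OPT
        0≼OPT = ≼-trans (0≼⨆ (load b H*) (allFin (suc n))) (≤ᴿ⇒≼ max≤)
        opt : ∀ v → load b H* v ≼ OPT
        opt v = ≼-trans (⨆-upper (load b H*) (allFin (suc n)) (∈-allFin v)) (≤ᴿ⇒≼ max≤)
    in ≼⇒≤ᴿ (≼-trans (maxLoad≼ G b {H* = H*} opt 0≼OPT H*⊆G conn (All.map proj₂ ends) ρ u {L} hi) (×ᴿ≼log₂ {n = n} {L} lo hi 0≼OPT))
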